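{- For $k\ge0$ let $f_k=f_k(z)$ (resp. $g_k=g_k(z)$) be the generating function, with respect to the size, of grand zigzag knight's paths of altitude $k$ ending with $E$ or $N$ (resp. with $\bar E$ or $\bar N$), where the empty path is counted in $f_0$. Put $F(u)=\sum_{k\ge0}f_k(z)u^k$ and $G(u)=\sum_{k\ge0}g_k(z)u^k$. Let $$r=\frac{1-z^4-z^2-\sqrt{z^8-2z^6-z^4-2z^2+1}}{2z^3},\qquad s=\frac{1-z^4-z^2+\sqrt{z^8-2z^6-z^4-2z^2+1}}{2z^3}.$$ Then $$F(u)=\frac{ -u^2-u(r+z)-z^2f_0s}{z^2(u-s)},\qquad G(u)=\frac{ -z^2u-z^2f_0s+z^2s}{z^2(u-s)},\qquad\text{where } f_0=\frac{r(z-1)}{z^3(rz^2+z-1)}.$$ The bivariate generating function $H(u):=F(u)+G(u)$ for the number of grand zigzag knight's paths ending at a non-negative $y$-coordinate, with respect to the size (marked by $z$) and the altitude (marked by $u$), is $$H(u)=-\frac{u^2+u(r+z+z^2)+z^2s(2f_0-1)}{z^2(u-s)}.$$ The generating function (with respect to the size) for the total number of grand zigzag knight's paths ending at a non-negative $y$-coordinate is $$H(1)=-\frac{1+r+z+z^2+z^2s(2f_0-1)}{z^2(1-s)}.$$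
   Context: A grand zigzag knight's path is a lattice path in $\mathbb{Z}^2$ starting at the origin, made of steps $N=(1,2)$, $\bar N=(1,-2)$, $E=(2,1)$, $\bar E=(2,-1)$, such that the vertical components of two consecutive steps never have the same direction (up-steps $N,E$ and down-steps $\bar N,\bar E$ alternate); the empty path is allowed. The size is the $x$-coordinate of the last point and the altitude is the $y$-coordinate of the last point. The square root is the branch (power series in $z$) with value $1$ at $z=0$, so $r$ is a power series in $z$ with leading term $z^3$ and $s=1/r$ is a Laurent series; rational expressions in $u$ are expanded as power series in $u$. -}

module Defs where

open import Algebra.Bundles using (module CommutativeRing)
open import Algebra.Bundles.Raw using (RawRing)
import Algebra.Definitions as AlgebraDefinitions
import Algebra.Definitions.RawSemiring as RawSemiringDefinitions
import Algebra.Properties.Monoid.Sum as MonoidSum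
open import Data.Bool.Base using (if_then_else_)
open import Data.Fin.Base using (Fin; toℕ; fromℕ; inject₁)
import Data.Fin.Properties as Fin
open import Data.Integer.Base as ℤ using (ℤ; +_; -[1+_])
import Data.Integer.Properties as ℤ
open import Data.List.Base
  using (List; []; _∷_; [_]; length; map; filter; upTo; head; foldr; concatMap; cartesianProductWith)
open import Data.List.Relation.Unary.Linked as Linked using (Linked)
open import Data.Maybe.Relation.Unary.All as MaybeAll using ()
open import Data.Maybe.Relation.Unary.Any as MaybeAny using ()
open import Data.Nat.Base as ℕ using (ℕ; zero; suc; _∸_; _≤_; z≤n)
open import Data.Nat.ListAction using (sum)
import Data.Nat.Properties as ℕ
open import Data.Product.Base using (_,_; ∃)
open import Data.Rational.Base as ℚ using (ℚ; ½; 1ℚ)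
import Data.Rational.Properties as ℚ
open import Data.Rational.Solver using (module +-*-Solver)
open import Data.Sign.Base as Sign using (Sign)
import Data.Sign.Properties as Sign
open import Level using (0ℓ)
open import Relation.Binary.PropositionalEquality
  using (_≡_; _≢_; refl; sym; cong; cong₂; module ≡-Reasoning)
open import Relation.Nullary.Decidable using (does; yes; no; ¬?; _×-dec_; dec-true; dec-false)
open import Relation.Unary using (Pred; Decidable)

module Arith {c ℓ} (R : RawRing c ℓ) where
  open RawRing R public
  open RawSemiringDefinitions rawSemiring public using (_^_) renaming (sum to ∑)
  open AlgebraDefinitions _≈_ using (Invertible)

  infixl 6 _-_
  _-_ : Carrier → Carrier → Carrier
  x - y = x + - y

  2# : Carrier
  2# = 1# + 1#

  -- A quotient carries the claim that its denominator is a unit.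
  infix 4 _≈_/_
  _≈_/_ : Carrier → Carrier → Carrier → Set _
  x ≈ a / b = ∃ λ ((b⁻¹ , _) : Invertible 1# _*_ b) → x ≈ a * b⁻¹

module _ {c ℓ} (R : RawRing c ℓ) where
  private module R = Arith R

  constant : R.Carrier → ℕ → R.Carrier
  constant a zero    = a
  constant a (suc _) = R.0#

  indeterminate : ℕ → R.Carrier
  indeterminate 1 = R.1#
  indeterminate _ = R.0#

  PowerSeries : RawRing c ℓ
  PowerSeries = record
    { Carrier = ℕ → R.Carrier
    ; _≈_     = λ a b → ∀ n → a n R.≈ b n
    ; _+_     = λ a b n → a n R.+ b n
    ; _*_     = λ a b n → R.∑ {suc n} λ i → a (toℕ i) R.* b (n ∸ toℕ i)
    ; -_      = λ a n → R.- (a n)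
    ; 0#      = constant R.0#
    ; 1#      = constant R.1#
    }

ℚ⟦z⟧ : RawRing 0ℓ 0ℓ
ℚ⟦z⟧ = PowerSeries ℚ.+-*-rawRing

Series : Set
Series = RawRing.Carrier ℚ⟦z⟧

-- The ring ℚ((z)) as the localisation of ℚ[[z]] at z; as z is not a zero
-- divisor, two fractions are equal as soon as they are so after
-- cross-multiplication.
infix 5 _/z^_
record LaurentSeries : Set where
  constructor _/z^_
  field
    numerator : Series
    order     : ℕ

ℚ⦅z⦆ : RawRing 0ℓ 0ℓ
ℚ⦅z⦆ = record
  { Carrier = LaurentSeries
  ; _≈_     = λ { (a /z^ m) (b /z^ n) → X ^ n * a ≈ X ^ m * b }
  ; _+_     = λ { (a /z^ m) (b /z^ n) → X ^ n * a + X ^ m * b /z^ m ℕ.+ n }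
  ; _*_     = λ { (a /z^ m) (b /z^ n) → a * b /z^ m ℕ.+ n }
  ; -_      = λ { (a /z^ m) → - a /z^ m }
  ; 0#      = 0# /z^ 0
  ; 1#      = 1# /z^ 0
  }
  where
  open Arith ℚ⟦z⟧
  X = indeterminate ℚ.+-*-rawRing

fromSeries : Series → LaurentSeries
fromSeries a = a /z^ 0

ℚ⦅z⦆⟦u⟧ : RawRing 0ℓ 0ℓ
ℚ⦅z⦆⟦u⟧ = PowerSeries ℚ⦅z⦆

z : LaurentSeries
z = fromSeries (indeterminate ℚ.+-*-rawRing)

u : RawRing.Carrier ℚ⦅z⦆⟦u⟧
u = indeterminate ℚ⦅z⦆

⟨_⟩ : LaurentSeries → RawRing.Carrier ℚ⦅z⦆⟦u⟧
⟨_⟩ = constant ℚ⦅z⦆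

-- Convergence of ∑ₖ aₖ to t for the z-adic topology: the partial sums of
-- each coefficient are eventually constant.
_SumsTo_ : (ℕ → Series) → Series → Set
a SumsTo t = ∀ n → ∃ λ N → ∀ K → N ≤ K → ∑ {K} (λ k → a (toℕ k) n) ≡ t n
  where open Arith ℚ.+-*-rawRing using (∑)

-- At indices i ≤ n, √-upto a n i is the i-th coefficient δᵢ of √ a, where δ₀ = 1
-- and δₙ₊₁ solves aₙ₊₁ = 2 δₙ₊₁ + ∑ δⱼ₊₁ δₙ₋ⱼ (sum over 0 ≤ j < n).
√-upto : Series → ℕ → ℕ → ℚ
√-upto a zero    _ = 1ℚ
√-upto a (suc n) i =
  if does (i ℕ.≤? n) then δ i
  else ½ * (a (suc n) - ∑ {n} λ j → δ (suc (toℕ j)) * δ (n ∸ toℕ j))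
  where
  open Arith ℚ.+-*-rawRing
  δ = √-upto a n

-- The square root with constant term 1; meaningful when a 0 ≡ 1ℚ.
√_ : Series → Series
(√ a) n = √-upto a n n

private
  √-upto-stable : ∀ a n i → i ≤ n → √-upto a n i ≡ (√ a) i
  √-upto-stable a zero    .0 z≤n = refl
  √-upto-stable a (suc n) i  i≤1+n with i ℕ.≤? n
  ... | yes i≤n rewrite dec-true (i ℕ.≤? n) i≤n = √-upto-stable a n i i≤n
  ... | no  i≰n with refl ← ℕ.≤-antisym i≤1+n (ℕ.≰⇒> i≰n)
    rewrite dec-false (suc n ℕ.≤? n) ℕ.1+n≰n = refl

√-square : ∀ a → a 0 ≡ 1ℚ → RawRing._≈_ ℚ⟦z⟧ (RawRing._*_ ℚ⟦z⟧ (√ a) (√ a)) a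
√-square a a₀≡1 zero    = sym a₀≡1
√-square a a₀≡1 (suc n) = begin
  1ℚ * δ (suc n) + ∑ {suc n} t                   ≡⟨ cong (λ x → 1ℚ * δ (suc n) + x) (sum-init-last t) ⟩
  1ℚ * δ (suc n) + (∑ {n} (λ j → t (inject₁ j)) + t (fromℕ n))
    ≡⟨ cong₂ (λ x y → 1ℚ * δ (suc n) + (x + y)) (sum-cong-≗ middle) last-term ⟩
  1ℚ * δ (suc n) + (S + δ (suc n) * 1ℚ)          ≡⟨ cong (λ x → 1ℚ * x + (S + x * 1ℚ)) step ⟩
  1ℚ * (½ * (a (suc n) - S)) + (S + ½ * (a (suc n) - S) * 1ℚ)
    ≡⟨ solve 2 (λ x y → con 1ℚ :* (con ½ :* (x :+ :- y)) :+ (y :+ con ½ :* (x :+ :- y) :* con 1ℚ) := x)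
         refl (a (suc n)) S ⟩
  a (suc n)                                      ∎
  where
  open ≡-Reasoning
  open Arith ℚ.+-*-rawRing using (_+_; _*_; _-_; ∑)
  open MonoidSum (CommutativeRing.+-monoid ℚ.+-*-commutativeRing) using (sum-init-last; sum-cong-≗)
  open +-*-Solver
  δ = √ a
  t : Fin (suc n) → ℚ
  t j = δ (suc (toℕ j)) * δ (n ∸ toℕ j)
  s : Fin n → ℚ
  s j = √-upto a n (suc (toℕ j)) * √-upto a n (n ∸ toℕ j)
  S = ∑ {n} s
  step : δ (suc n) ≡ ½ * (a (suc n) - S)
  step rewrite dec-false (suc n ℕ.≤? n) ℕ.1+n≰n = refl
  middle : ∀ j → t (inject₁ j) ≡ s j
  middle j rewrite Fin.toℕ-inject₁ j =
    sym (cong₂ _*_ (√-upto-stable a n _ (Fin.toℕ<n j)) (√-upto-stable a n _ (ℕ.m∸n≤m n (toℕ j))))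
  last-term : t (fromℕ n) ≡ δ (suc n) * 1ℚ
  last-term rewrite Fin.toℕ-fromℕ n | ℕ.n∸n≡0 n = refl

module _ where
  open Arith ℚ⟦z⟧
  private
    X = indeterminate ℚ.+-*-rawRing
    half = constant ℚ.+-*-rawRing ½

  D : Series
  D = X ^ 8 - 2# * X ^ 6 - X ^ 4 - 2# * X ^ 2 + 1#

  D₀≡1 : D 0 ≡ 1ℚ
  D₀≡1 = refl

  r s : LaurentSeries
  r = half * (1# - X ^ 4 - X ^ 2 - √ D) /z^ 3
  s = half * (1# - X ^ 4 - X ^ 2 + √ D) /z^ 3

data Step : Set where
  N N̄ E Ē : Step

Δx : Step → ℕ
Δx N = 1
Δx N̄ = 1
Δx E = 2
Δx Ē = 2

Δy : Step → ℤ
Δy N = + 2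
Δy N̄ = -[1+ 1 ]
Δy E = + 1
Δy Ē = -[1+ 0 ]

-- A path is the list of its steps, the last step coming first.
Path : Set
Path = List Step

direction : Step → Sign
direction p = ℤ.sign (Δy p)

Zigzag : Pred Path 0ℓ
Zigzag = Linked λ p q → direction p ≢ direction q

zigzag? : Decidable Zigzag
zigzag? = Linked.linked? λ p q → ¬? (direction p Sign.≟ direction q)

size : Path → ℕ
size p = sum (map Δx p)

altitude : Path → ℤ
altitude p = foldr ℤ._+_ (+ 0) (map Δy p)

-- Holds for the empty path as well.
EndsUp : Pred Path 0ℓ
EndsUp p = MaybeAll.All (λ s → direction s ≡ Sign.+) (head p)

endsUp? : Decidable EndsUp
endsUp? p = MaybeAll.dec (λ s → direction s Sign.≟ Sign.+) (head p)

EndsDown : Pred Path 0ℓ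
EndsDown p = MaybeAny.Any (λ s → direction s ≡ Sign.-) (head p)

endsDown? : Decidable EndsDown
endsDown? p = MaybeAny.dec (λ s → direction s Sign.≟ Sign.-) (head p)

wordsOfLength : ℕ → List Path
wordsOfLength zero    = [ [] ]
wordsOfLength (suc m) = cartesianProductWith _∷_ (N ∷ N̄ ∷ E ∷ Ē ∷ []) (wordsOfLength m)

-- The number of zigzag paths of size n satisfying P.  As Δx ≥ 1, a path of
-- size n has at most n steps.
count : {P : Pred Path 0ℓ} → Decidable P → ℕ → ℕ
count P? n = length (filter (λ p → zigzag? p ×-dec size p ℕ.≟ n ×-dec P? p)
                            (concatMap wordsOfLength (upTo (suc n))))

generatingFunction : {P : Pred Path 0ℓ} → Decidable P → Series
generatingFunction P? n = + count P? n ℚ./ 1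

f g h : ℕ → Series
f k = generatingFunction λ p → altitude p ℤ.≟ + k ×-dec endsUp? p
g k = generatingFunction λ p → altitude p ℤ.≟ + k ×-dec endsDown? p
h k = generatingFunction λ p → altitude p ℤ.≟ + k

-- The total number of paths with non-negative altitude, by size.
h-total : Series
h-total = generatingFunction λ p → + 0 ℤ.≤? altitude p

f₀ : LaurentSeries
f₀ = fromSeries (f 0)

F G H : RawRing.Carrier ℚ⦅z⦆⟦u⟧
F k = fromSeries (f k)
G k = fromSeries (g k)
H k = fromSeries (h k)

H[1] : LaurentSeries
H[1] = fromSeries h-total

-- Deleting the last step of a path, and reflecting paths in the x-axis, gives
-- for wₖ = gₖ + [k = 0] the relations f₀ = w₀, f₁ = z f₁ + z² w₀,
-- fₖ₊₂ = z wₖ + z² wₖ₊₁ and wₖ = [k = 0] + z fₖ₊₂ + z² fₖ₊₁. Eliminating f,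
--   z³ wₖ₊₂ = (1 - z² - z⁴) wₖ₊₁ - z³ wₖ,
-- whose characteristic roots are r and s, with rs = 1. The kernel method takes
-- the following form: dₖ = wₖ₊₁ - r wₖ satisfies dₖ = r dₖ₊₁, so it is divisible
-- by all powers of r, hence of z, and vanishes. Therefore wₖ = rᵏ f₀, that is
-- G(u) + 1 = - s f₀ / (u - s), and F(u) and f₀ follow by algebra. For k ≥ 2 the
-- series hₖ = fₖ + gₖ are in geometric progression too, which yields H(1).
module Submission where

open import Algebra.Bundles using (CommutativeRing)
open import Algebra.Bundles.Raw using (RawRing)
import Algebra.Consequences.Setoid as Consequences
import Algebra.Properties.AbelianGroup as AbelianGroupProperties
import Algebra.Properties.CommutativeMonoid.Sum as CommutativeMonoidSum
import Algebra.Properties.Ring as RingProperties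
import Algebra.Properties.Semiring.Exp as Exp
import Algebra.Properties.Semiring.Mult.TCOptimised as Mult
import Algebra.Properties.Semiring.Sum as SemiringSum
import Algebra.Solver.Ring as Solver
open import Algebra.Solver.Ring.AlmostCommutativeRing
  using (fromCommutativeRing; _-Raw-AlmostCommutative⟶_)
open import Data.Fin.Base as Fin using (Fin)
open import Data.Integer.Base as ℤ using (ℤ; +_; -[1+_])
import Data.Integer.Properties as ℤ
open import Data.Maybe.Base using (Maybe; just; nothing)
open import Data.Nat.Base as ℕ using (ℕ; zero; suc)
import Data.Nat.Properties as ℕ
open import Data.Product.Base using (_,_; proj₁; proj₂; ∃)
open import Function.Base using (_∘_)
open import Level using (0ℓ; _⊔_)
open import Relation.Binary.Bundles using (Setoid)
import Relation.Binary.Reasoning.Setoid as SetoidReasoning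
open import Relation.Binary.PropositionalEquality as ≡ using (_≡_)
open import Relation.Binary.Structures using (IsEquivalence)
open import Relation.Nullary.Decidable using (yes; no)
open import Defs using (module Arith; PowerSeries; constant; indeterminate)

-- Commutative rings and power series

-- Each quotient in the statement carries a proof that its denominator is a unit, so inverses must
-- be produced. For `u - s` it is `- r / (1 - r u)`. For `r z² + z - 1` it comes from
-- `f₀ σ (r z² + z - 1) = z - 1` with `σ = z³ s`, as `1 - z` is a unit. For `1 - s` it comes from
-- the factorisation of `1 - z² - 2z³ - z⁴` through `1 - r` and `z³ - σ`. Setting `u = 1` is not
-- defined on all power series in `u`, so H(1) cannot be read off from H(u): `h-total` is shown to
-- be the z-adic sum of the `h k`, and the closed forms are derived a second time with the scalar 1
-- in place of `u`. The argument that infinite divisibility forces 0 lives in power series, whereas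
-- `s` has a pole. All equations between `f`, `g` and `w` are therefore proved over the power series
-- in `z`, where `z` can be cancelled but not inverted, and are then carried along homomorphisms to
-- Laurent series and to power series in `u`. The algebra itself consists of polynomial identities
-- valid in any commutative ring.

module IntegerSolver {c ℓ} (R : CommutativeRing c ℓ) where
  open CommutativeRing R
  open RingProperties ring
  open AbelianGroupProperties +-abelianGroup using (⁻¹-∙-comm)
  open Mult semiring using (_×_; 1+×; ×-homo-+; ×1-homo-*)
  open SetoidReasoning setoid

  -- With the optimised multiple, `⟦ + 1 ⟧ℤ` reduces to `1#` itself and not to a sum with `0#`, so
  -- `con (+ 1)` in a solver equation denotes the literal unit.
  ⟦_⟧ℤ : ℤ → Carrier
  ⟦ + n ⟧ℤ      = n × 1#
  ⟦ -[1+ n ] ⟧ℤ = - (suc n × 1#)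

  ⊖-homo : ∀ m n → ⟦ m ℤ.⊖ n ⟧ℤ ≈ m × 1# + - (n × 1#)
  ⊖-homo zero    zero    = sym (-‿inverseʳ 0#)
  ⊖-homo zero    (suc n) = sym (+-identityˡ _)
  ⊖-homo (suc m) zero    = sym (trans (+-congˡ -0#≈0#) (+-identityʳ _))
  ⊖-homo (suc m) (suc n) = begin
    ⟦ suc m ℤ.⊖ suc n ⟧ℤ                    ≡⟨ ≡.cong ⟦_⟧ℤ (ℤ.[1+m]⊖[1+n]≡m⊖n m n) ⟩
    ⟦ m ℤ.⊖ n ⟧ℤ                            ≈⟨ ⊖-homo m n ⟩
    x + - y                                 ≈⟨ +-congʳ (+-identityʳ x) ⟨
    x + 0# + - y                            ≈⟨ +-congʳ (+-congˡ (-‿inverseʳ 1#)) ⟨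
    x + (1# + - 1#) + - y                   ≈⟨ +-congʳ (+-assoc x 1# (- 1#)) ⟨
    x + 1# + - 1# + - y                     ≈⟨ +-assoc (x + 1#) (- 1#) (- y) ⟩
    x + 1# + (- 1# + - y)                   ≈⟨ +-cong (+-comm x 1#) (⁻¹-∙-comm 1# y) ⟩
    1# + x + - (1# + y)                     ≈⟨ +-cong (1+× m 1#) (-‿cong (1+× n 1#)) ⟨
    suc m × 1# + - (suc n × 1#)             ∎
    where
    x = m × 1#
    y = n × 1#

  -‿homo : ∀ i → ⟦ ℤ.- i ⟧ℤ ≈ - ⟦ i ⟧ℤ
  -‿homo (+ zero)  = sym -0#≈0#
  -‿homo (+ suc n) = refl
  -‿homo -[1+ n ]  = sym (-‿involutive _)

  +-homo : ∀ i j → ⟦ i ℤ.+ j ⟧ℤ ≈ ⟦ i ⟧ℤ + ⟦ j ⟧ℤ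
  +-homo (+ m)    (+ n)    = ×-homo-+ 1# m n
  +-homo (+ m)    -[1+ n ] = ⊖-homo m (suc n)
  +-homo -[1+ m ] (+ n)    = trans (⊖-homo n (suc m)) (+-comm _ _)
  +-homo -[1+ m ] -[1+ n ] = begin
    - (suc (suc (m ℕ.+ n)) × 1#)     ≡⟨ ≡.cong (λ k → - (suc k × 1#)) (ℕ.+-suc m n) ⟨
    - ((suc m ℕ.+ suc n) × 1#)       ≈⟨ -‿cong (×-homo-+ 1# (suc m) (suc n)) ⟩
    - (suc m × 1# + suc n × 1#)      ≈⟨ ⁻¹-∙-comm _ _ ⟨
    - (suc m × 1#) + - (suc n × 1#)  ∎

  *-homo-+ : ∀ m j → ⟦ + m ℤ.* j ⟧ℤ ≈ m × 1# * ⟦ j ⟧ℤ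
  *-homo-+ m (+ n)    = trans (reflexive (≡.cong ⟦_⟧ℤ (≡.sym (ℤ.pos-* m n)))) (×1-homo-* m n)
  *-homo-+ m -[1+ n ] = begin
    ⟦ + m ℤ.* -[1+ n ] ⟧ℤ        ≡⟨ ≡.cong ⟦_⟧ℤ (ℤ.neg-distribʳ-* (+ m) (+ suc n)) ⟨
    ⟦ ℤ.- (+ m ℤ.* + suc n) ⟧ℤ   ≈⟨ -‿homo (+ m ℤ.* + suc n) ⟩
    - ⟦ + m ℤ.* + suc n ⟧ℤ       ≈⟨ -‿cong (*-homo-+ m (+ suc n)) ⟩
    - (m × 1# * (suc n × 1#))    ≈⟨ -‿distribʳ-* _ _ ⟩
    m × 1# * - (suc n × 1#)      ∎

  *-homo : ∀ i j → ⟦ i ℤ.* j ⟧ℤ ≈ ⟦ i ⟧ℤ * ⟦ j ⟧ℤ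
  *-homo (+ m)    j = *-homo-+ m j
  *-homo -[1+ m ] j = begin
    ⟦ -[1+ m ] ℤ.* j ⟧ℤ        ≡⟨ ≡.cong ⟦_⟧ℤ (ℤ.neg-distribˡ-* (+ suc m) j) ⟨
    ⟦ ℤ.- (+ suc m ℤ.* j) ⟧ℤ   ≈⟨ -‿homo (+ suc m ℤ.* j) ⟩
    - ⟦ + suc m ℤ.* j ⟧ℤ       ≈⟨ -‿cong (*-homo-+ (suc m) j) ⟩
    - (suc m × 1# * ⟦ j ⟧ℤ)    ≈⟨ -‿distribˡ-* _ _ ⟩
    - (suc m × 1#) * ⟦ j ⟧ℤ    ∎

  morphism : ℤ.+-*-rawRing -Raw-AlmostCommutative⟶ fromCommutativeRing R
  morphism = record
    { ⟦_⟧ = ⟦_⟧ℤ ; +-homo = +-homo ; *-homo = *-homo ; -‿homo = -‿homo ; 0-homo = refl ; 1-homo = refl }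

  -- Equality of power series is undecidable, so coefficients are compared in the integers. This is
  -- sound in every ring and suffices for identities that hold with integer coefficients.
  coefficient≟ : ∀ i j → Maybe (⟦ i ⟧ℤ ≈ ⟦ j ⟧ℤ)
  coefficient≟ i j with i ℤ.≟ j
  ... | yes i≡j = just (reflexive (≡.cong ⟦_⟧ℤ i≡j))
  ... | no  _   = nothing

  open Solver ℤ.+-*-rawRing (fromCommutativeRing R) morphism coefficient≟ public
    using (solve; _:=_; con; _:+_; _:*_; :-_; _:-_; _:^_)

  x≈y⇒x-y≈0 : ∀ {x y} → x ≈ y → x + - y ≈ 0#
  x≈y⇒x-y≈0 {x} {y} x≈y = trans (+-congʳ x≈y) (-‿inverseʳ y)

  x-y≈0⇒x≈y : ∀ {x y} → x + - y ≈ 0# → x ≈ y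
  x-y≈0⇒x≈y {x} {y} eq = begin
    x              ≈⟨ solve 2 (λ x y → x := x :- y :+ y) refl x y ⟩
    x + - y + y    ≈⟨ +-congʳ eq ⟩
    0# + y         ≈⟨ +-identityˡ y ⟩
    y              ∎

module _ {c ℓ} (R : RawRing c ℓ) where
  open RawRing R

  -- One half of each two-sided law is enough, since commutativity supplies the other. Power series
  -- and Laurent series both become rings through this list.
  record CommutativeRingLaws : Set (c ⊔ ℓ) where
    field
      isEquivalence : IsEquivalence _≈_
      +-cong        : ∀ {x y v w} → x ≈ y → v ≈ w → x + v ≈ y + w
      +-assoc       : ∀ x y v → (x + y) + v ≈ x + (y + v)
      +-comm        : ∀ x y → x + y ≈ y + x
      +-identityˡ   : ∀ x → 0# + x ≈ x
      -‿cong        : ∀ {x y} → x ≈ y → - x ≈ - y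
      -‿inverseˡ    : ∀ x → - x + x ≈ 0#
      *-cong        : ∀ {x y v w} → x ≈ y → v ≈ w → x * v ≈ y * w
      *-assoc       : ∀ x y v → (x * y) * v ≈ x * (y * v)
      *-comm        : ∀ x y → x * y ≈ y * x
      *-identityˡ   : ∀ x → 1# * x ≈ x
      distribʳ      : ∀ x y v → (y + v) * x ≈ y * x + v * x

    commutativeRing : CommutativeRing c ℓ
    commutativeRing = record
      { isCommutativeRing = record
        { isRing = record
          { +-isAbelianGroup = record
            { isGroup = record
              { isMonoid = record
                { isSemigroup = record
                  { isMagma = record { isEquivalence = isEquivalence ; ∙-cong = +-cong }
                  ; assoc = +-assoc
                  }
                ; identity = comm∧idˡ⇒id +-comm +-identityˡ
                }
              ; inverse = comm∧invˡ⇒inv +-comm -‿inverseˡ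
              ; ⁻¹-cong = -‿cong
              }
            ; comm = +-comm
            }
          ; *-cong = *-cong
          ; *-assoc = *-assoc
          ; *-identity = comm∧idˡ⇒id *-comm *-identityˡ
          ; distrib = comm∧distrʳ⇒distr +-cong *-comm distribʳ
          }
        ; *-comm = *-comm
        }
      }
      where
      setoid : Setoid c ℓ
      setoid = record { isEquivalence = isEquivalence }
      open Consequences setoid

module PowerSeriesProperties {c ℓ} (R : CommutativeRing c ℓ) where
  open CommutativeRing R
  open IntegerSolver R
  open SetoidReasoning setoid
  private
    module P = Arith (PowerSeries rawRing)
    module A = Arith rawRing

  ∑-cong : ∀ n {x y} → (∀ i → x i ≈ y i) → A.∑ {n} x ≈ A.∑ {n} y
  ∑-cong zero    x≈y = refl
  ∑-cong (suc n) x≈y = +-cong (x≈y _) (∑-cong n (x≈y ∘ Fin.suc))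

  *-cong-series : ∀ {a b c d} → a P.≈ b → c P.≈ d → a P.* c P.≈ b P.* d
  *-cong-series a≈b c≈d n = ∑-cong (suc n) (λ i → *-cong (a≈b (Fin.toℕ i)) (c≈d (n ℕ.∸ Fin.toℕ i)))

  -- (a * b) (suc n) unfolds to a 0 * b (suc n) + ((a ∘ suc) * b) n.
  *-zero-below : ∀ n {a} b → (∀ {i} → i ℕ.≤ n → a i ≈ 0#) → (a P.* b) n ≈ 0#
  *-zero-below zero    b a≈0 = trans (+-congʳ (trans (*-congʳ (a≈0 ℕ.z≤n)) (zeroˡ _))) (+-identityˡ _)
  *-zero-below (suc n) {a} b a≈0 = begin
    a 0 * b (suc n) + ((a ∘ suc) P.* b) n ≈⟨ +-cong (*-congʳ (a≈0 ℕ.z≤n)) (*-zero-below n b (a≈0 ∘ ℕ.s≤s)) ⟩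
    0# * b (suc n) + 0#                   ≈⟨ solve 1 (λ x → con (+ 0) :* x :+ con (+ 0) := con (+ 0)) refl _ ⟩
    0#                                    ∎

  distribʳ-series : ∀ a b c → (b P.+ c) P.* a P.≈ (b P.* a P.+ c P.* a)
  distribʳ-series a b c zero    = solve 3 (λ x y w → (y :+ w) :* x :+ con (+ 0) :=
    (y :* x :+ con (+ 0)) :+ (w :* x :+ con (+ 0))) refl (a 0) (b 0) (c 0)
  distribʳ-series a b c (suc n) = trans (+-congˡ (distribʳ-series a (b ∘ suc) (c ∘ suc) n))
    (solve 5 (λ x y w v v′ → (y :+ w) :* x :+ (v :+ v′) := (y :* x :+ v) :+ (w :* x :+ v′)) refl
      (a (suc n)) (b 0) (c 0) _ _)

  scale-* : ∀ x a b n → ((λ i → x * a i) P.* b) n ≈ x * (a P.* b) n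
  scale-* x a b zero    = solve 3 (λ x a b → x :* a :* b :+ con (+ 0) := x :* (a :* b :+ con (+ 0)))
    refl x (a 0) (b 0)
  scale-* x a b (suc n) = trans (+-congˡ (scale-* x (a ∘ suc) b n))
    (solve 4 (λ x a b v → x :* a :* b :+ x :* v := x :* (a :* b :+ v)) refl x (a 0) (b (suc n)) _)

  -- Removing the constant term of `a * b` leaves `a 0` times the shift of `b`, plus the shift of
  -- `a` times `b`. Distributivity and scaling separate the two parts, and the induction hypothesis
  -- applies to the second with `a` shifted.
  *-assoc-series : ∀ a b c → (a P.* b) P.* c P.≈ a P.* (b P.* c)
  *-assoc-series a b c zero    = solve 3 (λ x y w → (x :* y :+ con (+ 0)) :* w :+ con (+ 0) :=
    x :* (y :* w :+ con (+ 0)) :+ con (+ 0)) refl (a 0) (b 0) (c 0)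
  *-assoc-series a b c (suc n) = begin
    (a 0 * b 0 + 0#) * c (suc n) + (((λ i → a 0 * b (suc i)) P.+ (a ∘ suc) P.* b) P.* c) n
      ≈⟨ +-congˡ (distribʳ-series c (λ i → a 0 * b (suc i)) ((a ∘ suc) P.* b) n) ⟩
    (a 0 * b 0 + 0#) * c (suc n) + (((λ i → a 0 * b (suc i)) P.* c) n + (((a ∘ suc) P.* b) P.* c) n)
      ≈⟨ +-congˡ (+-cong (scale-* (a 0) (b ∘ suc) c n) (*-assoc-series (a ∘ suc) b c n)) ⟩
    (a 0 * b 0 + 0#) * c (suc n) + (a 0 * ((b ∘ suc) P.* c) n + ((a ∘ suc) P.* (b P.* c)) n)
      ≈⟨ solve 5 (λ x y w v v′ → (x :* y :+ con (+ 0)) :* w :+ (x :* v :+ v′) := x :* (y :* w :+ v) :+ v′)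
           refl (a 0) (b 0) (c (suc n)) _ _ ⟩
    a 0 * (b 0 * c (suc n) + ((b ∘ suc) P.* c) n) + ((a ∘ suc) P.* (b P.* c)) n ∎

  -- The mirror image of the definitional unfolding: it splits off the constant term of the right
  -- factor. Commutativity follows by matching the two unfoldings.
  *-suc : ∀ a b n → (a P.* b) (suc n) ≈ a (suc n) * b 0 + (a P.* (b ∘ suc)) n
  *-suc a b zero    = solve 4 (λ x y v w → x :* y :+ (v :* w :+ con (+ 0)) := v :* w :+ (x :* y :+ con (+ 0)))
    refl (a 0) (b 1) (a 1) (b 0)
  *-suc a b (suc n) = trans (+-congˡ (*-suc (a ∘ suc) b n))
    (solve 3 (λ x y v → x :+ (y :+ v) := y :+ (x :+ v)) refl _ _ _)

  *-comm-series : ∀ a b → a P.* b P.≈ b P.* a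
  *-comm-series a b zero    = +-congʳ (*-comm (a 0) (b 0))
  *-comm-series a b (suc n) = trans (+-cong (*-comm _ _) (*-comm-series (a ∘ suc) b n)) (sym (*-suc b a n))

  *-identityˡ-series : ∀ a → P.1# P.* a P.≈ a
  *-identityˡ-series a zero    = solve 1 (λ x → con (+ 1) :* x :+ con (+ 0) := x) refl (a 0)
  *-identityˡ-series a (suc n) = trans (+-congˡ (*-zero-below n a (λ _ → refl)))
    (solve 1 (λ x → con (+ 1) :* x :+ con (+ 0) := x) refl (a (suc n)))

  powerSeries-laws : CommutativeRingLaws (PowerSeries rawRing)
  powerSeries-laws = record
    { isEquivalence = record
      { refl  = λ n → refl
      ; sym   = λ a≈b n → sym (a≈b n)
      ; trans = λ a≈b b≈c n → trans (a≈b n) (b≈c n)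
      }
    ; +-cong      = λ a≈b c≈d n → +-cong (a≈b n) (c≈d n)
    ; +-assoc     = λ a b c n → +-assoc (a n) (b n) (c n)
    ; +-comm      = λ a b n → +-comm (a n) (b n)
    ; +-identityˡ = λ { a zero → +-identityˡ (a 0) ; a (suc n) → +-identityˡ (a (suc n)) }
    ; -‿cong      = λ a≈b n → -‿cong (a≈b n)
    ; -‿inverseˡ  = λ { a zero → -‿inverseˡ (a 0) ; a (suc n) → -‿inverseˡ (a (suc n)) }
    ; *-cong      = *-cong-series
    ; *-assoc     = *-assoc-series
    ; *-comm      = *-comm-series
    ; *-identityˡ = *-identityˡ-series
    ; distribʳ    = distribʳ-series
    }

  powerSeriesRing : CommutativeRing c ℓ
  powerSeriesRing = CommutativeRingLaws.commutativeRing powerSeries-laws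

  private X = indeterminate rawRing

  X*-zero : ∀ a → (X P.* a) 0 ≈ 0#
  X*-zero a = solve 1 (λ x → con (+ 0) :* x :+ con (+ 0) := con (+ 0)) refl (a 0)

  X*-suc : ∀ a n → (X P.* a) (suc n) ≈ a n
  X*-suc a n = begin
    0# * a (suc n) + ((X ∘ suc) P.* a) n ≈⟨ solve 2 (λ x y → con (+ 0) :* x :+ y := y) refl (a (suc n)) _ ⟩
    ((X ∘ suc) P.* a) n                  ≈⟨ *-cong-series {c = a} X∘suc≈1 (λ _ → refl) n ⟩
    (P.1# P.* a) n                       ≈⟨ *-identityˡ-series a n ⟩
    a n                                  ∎
    where
    X∘suc≈1 : (X ∘ suc) P.≈ P.1#
    X∘suc≈1 zero    = refl
    X∘suc≈1 (suc _) = refl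

  X*-cancel : ∀ a b → X P.* a P.≈ X P.* b → a P.≈ b
  X*-cancel a b eq n = trans (sym (X*-suc a n)) (trans (eq (suc n)) (X*-suc b n))

  X³*-shift : ∀ a → a 0 ≈ 0# → a 1 ≈ 0# → a 2 ≈ 0# → a P.≈ X P.* (X P.* (X P.* λ n → a (3 ℕ.+ n)))
  X³*-shift a a₀≈0 a₁≈0 a₂≈0 = shift
    where
    a₊₃ : ℕ → Carrier
    a₊₃ n = a (3 ℕ.+ n)
    shift : a P.≈ X P.* (X P.* (X P.* a₊₃))
    shift 0 = trans a₀≈0 (sym (X*-zero (X P.* (X P.* a₊₃))))
    shift 1 = trans a₁≈0 (sym (trans (X*-suc (X P.* (X P.* a₊₃)) 0) (X*-zero (X P.* a₊₃))))
    shift 2 = trans a₂≈0 (sym (trans (X*-suc (X P.* (X P.* a₊₃)) 1)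
      (trans (X*-suc (X P.* a₊₃) 0) (X*-zero a₊₃))))
    shift (suc (suc (suc n))) = sym (trans (X*-suc (X P.* (X P.* a₊₃)) (suc (suc n)))
      (trans (X*-suc (X P.* a₊₃) (suc n)) (X*-suc a₊₃ n)))

  constant-* : ∀ x a n → (constant rawRing x P.* a) n ≈ x * a n
  constant-* x a zero    = +-identityʳ _
  constant-* x a (suc n) = trans (+-congˡ (*-zero-below n a (λ _ → refl))) (+-identityʳ _)

  -- Iterating d k ≈ ρ * d (suc k) shows that d k is divisible by every power of ρ.
  infinitely-divisible⇒0 : ∀ {ρ} {d : ℕ → ℕ → Carrier} → ρ 0 ≈ 0# → (∀ k → d k P.≈ ρ P.* d (suc k)) →
    ∀ n {i} → i ℕ.≤ n → ∀ k → d k i ≈ 0#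
  infinitely-divisible⇒0 {ρ} {d} ρ₀≈0 divisible n {zero} _ k = begin
    d k 0                     ≈⟨ divisible k 0 ⟩
    ρ 0 * d (suc k) 0 + 0#    ≈⟨ +-congʳ (*-congʳ ρ₀≈0) ⟩
    0# * d (suc k) 0 + 0#     ≈⟨ solve 1 (λ x → con (+ 0) :* x :+ con (+ 0) := con (+ 0)) refl _ ⟩
    0#                        ∎
  infinitely-divisible⇒0 {ρ} {d} ρ₀≈0 divisible (suc n) {suc i} (ℕ.s≤s i≤n) k = begin
    d k (suc i)                                             ≈⟨ divisible k (suc i) ⟩
    -- As `ρ 0` vanishes, only the coefficients of `d (suc k)` of index at most `i` contribute, and
    -- these are 0 by induction on the bound `n`. The factors are swapped because `*-zero-below`
    -- wants the vanishing one on the left.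
    ρ 0 * d (suc k) (suc i) + ((ρ ∘ suc) P.* d (suc k)) i   ≈⟨ +-cong (*-congʳ ρ₀≈0) (*-comm-series (ρ ∘ suc) (d (suc k)) i) ⟩
    0# * d (suc k) (suc i) + (d (suc k) P.* (ρ ∘ suc)) i    ≈⟨ +-congˡ (*-zero-below i (ρ ∘ suc) λ j≤i →
                                                                 infinitely-divisible⇒0 {ρ} {d} ρ₀≈0 divisible n (ℕ.≤-trans j≤i i≤n) (suc k)) ⟩
    0# * d (suc k) (suc i) + 0#                             ≈⟨ solve 1 (λ x → con (+ 0) :* x :+ con (+ 0) := con (+ 0)) refl _ ⟩
    0#                                                      ∎

-- The kernel equation

-- The Laurent series s is replaced by the power series σ = z³ s wherever possible.
module RingIdentities {c ℓ} (R : CommutativeRing c ℓ) where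
  open CommutativeRing R hiding (_-_)
  open Arith rawRing using (_^_; _-_; 2#; _≈_/_)
  open IntegerSolver R

  -- An equation A ≈ B is derived from equations Lᵢ ≈ Rᵢ by exhibiting
  -- A - B as ∑ cᵢ (Lᵢ - Rᵢ), an identity that the ring solver verifies.
  null : ∀ c {x y} → x ≈ y → c * (x + - y) ≈ 0#
  null c x≈y = trans (*-congˡ (x≈y⇒x-y≈0 x≈y)) (zeroʳ c)

  infixl 4 _⊹_
  _⊹_ : ∀ {x y} → x ≈ 0# → y ≈ 0# → x + y ≈ 0#
  x≈0 ⊹ y≈0 = trans (+-cong x≈0 y≈0) (+-identityˡ 0#)

  combination : ∀ {x y v} → x + - y ≈ v → v ≈ 0# → x ≈ y
  combination eq v≈0 = x-y≈0⇒x≈y (trans eq v≈0)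

  quotient : ∀ {x a b} b⁻¹ → b⁻¹ * b ≈ 1# → x * b ≈ a → x ≈ a / b
  quotient {x} {a} {b} b⁻¹ inverseˡ xb≈a = (b⁻¹ , inverseˡ , trans (*-comm b b⁻¹) inverseˡ) ,
    combination (solve 4 (λ x a b y → x :- a :* y := y :* (x :* b :- a) :+ (:- x) :* (y :* b :- con (+ 1))) refl x a b b⁻¹)
      (null b⁻¹ xb≈a ⊹ null (- x) inverseˡ)

  module Kernel
    {z ρ σ : Carrier}
    (ρσ≈z³ : ρ * σ ≈ z ^ 3) (z³ρ+σ : z ^ 3 * ρ + σ ≈ 1# - z ^ 4 - z ^ 2) where

    -- The two hypotheses on `σ` combine to the quadratic equation `z³ ρ² + z³ = (1 - z² - z⁴) ρ`.
    -- Multiplying the recurrence for `w` by `ρ` and inserting this equation splits it into the two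
    -- defects. The factor `z³` remains since `z` is not a unit here.
    step-back : ∀ {w₀ w₁ w₂ f₂ f₃} → w₁ ≈ z * f₃ + z * (z * f₂) →
      f₂ ≈ z * w₀ + z * (z * w₁) → f₃ ≈ z * w₁ + z * (z * w₂) →
      z ^ 3 * (w₁ - ρ * w₀) ≈ z ^ 3 * (ρ * (w₂ - ρ * w₁))
    step-back {w₀} {w₁} {w₂} {f₂} {f₃} eq₁ eq₂ eq₃ = combination
      (solve 8 (λ z r s w₀ w₁ w₂ f₂ f₃ →
         z :^ 3 :* (w₁ :- r :* w₀) :- z :^ 3 :* (r :* (w₂ :- r :* w₁)) :=
         r :* (w₁ :- (z :* f₃ :+ z :* (z :* f₂)))
         :+ r :* z :^ 2 :* (f₂ :- (z :* w₀ :+ z :* (z :* w₁)))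
         :+ r :* z :* (f₃ :- (z :* w₁ :+ z :* (z :* w₂)))
         :+ :- w₁ :* (r :* s :- z :^ 3)
         :+ r :* w₁ :* (z :^ 3 :* r :+ s :- (con (+ 1) :- z :^ 4 :- z :^ 2)))
       refl z ρ σ w₀ w₁ w₂ f₂ f₃)
      (null ρ eq₁ ⊹ null (ρ * z ^ 2) eq₂ ⊹ null (ρ * z) eq₃ ⊹ null (- w₁) ρσ≈z³ ⊹ null (ρ * w₁) z³ρ+σ)

    module Defect (z³*-cancel : ∀ x y → z ^ 3 * x ≈ z ^ 3 * y → x ≈ y) {f w : ℕ → Carrier}
      (w-suc : ∀ k → w (suc k) ≈ z * f (suc (suc (suc k))) + z * (z * f (suc (suc k))))
      (f-suc-suc : ∀ k → f (suc (suc k)) ≈ z * w k + z * (z * w (suc k))) where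

      defect : ℕ → Carrier
      defect k = w (suc k) - ρ * w k

      defect-divisible : ∀ k → defect k ≈ ρ * defect (suc k)
      defect-divisible k = z³*-cancel _ _ (step-back (w-suc k) (f-suc-suc k) (f-suc-suc (suc k)))

    module Scalar {f₀ f₁ f₂ : Carrier} (z*-cancel : ∀ {x y} → z * x ≈ z * y → x ≈ y) {e} (e-inverse : e * (1# - z) ≈ 1#)
      (f₁-eq : f₁ ≈ z * f₁ + z * (z * f₀)) (f₂-eq : f₂ ≈ z * f₀ + z * (z * (ρ * f₀)))
      (f₀-eq : f₀ ≈ 1# + (z * f₂ + z * (z * f₁))) where

      -- Eliminating `f₂` gives `(1 - z² - z³ρ) f₀ = 1 + z² f₁`, where the factor of `f₀` is
      -- `σ + z⁴`. The equation for `f₁` then absorbs `z⁴ f₀` and turns `z² f₁` into `z³ f₁`.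
      z³f₁+1≈σf₀ : z ^ 3 * f₁ + 1# ≈ σ * f₀
      z³f₁+1≈σf₀ = combination
        (solve 6 (λ z r s f₀ f₁ f₂ →
           z :^ 3 :* f₁ :+ con (+ 1) :- s :* f₀ :=
           :- (z :^ 2) :* (f₁ :- (z :* f₁ :+ z :* (z :* f₀)))
           :+ :- z :* (f₂ :- (z :* f₀ :+ z :* (z :* (r :* f₀))))
           :+ :- con (+ 1) :* (f₀ :- (con (+ 1) :+ (z :* f₂ :+ z :* (z :* f₁))))
           :+ :- f₀ :* (z :^ 3 :* r :+ s :- (con (+ 1) :- z :^ 4 :- z :^ 2)))
         refl z ρ σ f₀ f₁ f₂)
        (null _ f₁-eq ⊹ null _ f₂-eq ⊹ null _ f₀-eq ⊹ null _ z³ρ+σ)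

      κ : Carrier
      κ = ρ * z ^ 2 + z - 1#

      -- Inserting `(1 - z) f₁ = z² f₀` into the previous equation gives
      -- `f₀ (σ (1 - z) - z⁵) = 1 - z`, and `z⁵ = z² ρ σ` brings out the factor `κ`.
      f₀σκ≈z-1 : f₀ * σ * κ ≈ z - 1#
      f₀σκ≈z-1 = combination
        (solve 5 (λ z r s f₀ f₁ →
           f₀ :* s :* (r :* z :^ 2 :+ z :- con (+ 1)) :- (z :- con (+ 1)) :=
           z :^ 2 :* f₀ :* (r :* s :- z :^ 3)
           :+ (con (+ 1) :- z) :* (z :^ 3 :* f₁ :+ con (+ 1) :- s :* f₀)
           :+ :- (z :^ 3) :* (f₁ :- (z :* f₁ :+ z :* (z :* f₀))))
         refl z ρ σ f₀ f₁)
        (null _ ρσ≈z³ ⊹ null _ z³f₁+1≈σf₀ ⊹ null _ f₁-eq)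

      -- The equation for `f₀` also exhibits `κ` as a divisor of the unit `z - 1`.
      κ-inverse : - (f₀ * σ * e) * κ ≈ 1#
      κ-inverse = combination
        (solve 5 (λ z f₀ s e k → :- (f₀ :* s :* e) :* k :- con (+ 1) :=
           :- e :* (f₀ :* s :* k :- (z :- con (+ 1))) :+ con (+ 1) :* (e :* (con (+ 1) :- z) :- con (+ 1)))
         refl z f₀ σ e κ)
        (null _ f₀σκ≈z-1 ⊹ null _ e-inverse)

      κ*-cancel : ∀ {x y} → κ * x ≈ κ * y → x ≈ y
      κ*-cancel {x} {y} eq = combination
        (solve 4 (λ x y k v → x :- y := v :* (k :* x :- k :* y) :+ (y :- x) :* (v :* k :- con (+ 1)))
         refl x y κ (- (f₀ * σ * e)))
        (null _ eq ⊹ null _ κ-inverse)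

      -- This determines the coefficient of `u` in the numerator of `F`. Multiplied by `z² κ`, it
      -- loses `f₁` by `z³f₁+1≈σf₀` and `f₀` by `f₀σκ≈z-1`; what remains is
      -- `(z - 1)(σ + z⁴ - z²ρ) = (1 - z²) κ`, a consequence of `z³ρ+σ`.
      zf₁σ+z²f₀σ : z * f₁ * σ + z ^ 2 * f₀ * σ ≈ z ^ 3 * f₀ + z * (ρ + z)
      zf₁σ+z²f₀σ = z*-cancel (z*-cancel (κ*-cancel (combination
        (solve 5 (λ z r s f₀ f₁ → let k = r :* z :^ 2 :+ z :- con (+ 1) in
           k :* (z :* (z :* (z :* f₁ :* s :+ z :^ 2 :* f₀ :* s))) :- k :* (z :* (z :* (z :^ 3 :* f₀ :+ z :* (r :+ z)))) :=
           k :* s :* (z :^ 3 :* f₁ :+ con (+ 1) :- s :* f₀)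
           :+ (s :+ z :^ 4 :- z :^ 2 :* r) :* (f₀ :* s :* k :- (z :- con (+ 1)))
           :+ z :^ 2 :* f₀ :* k :* (r :* s :- z :^ 3)
           :+ :- (z :^ 2 :* r) :* (z :^ 3 :* r :+ s :- (con (+ 1) :- z :^ 4 :- z :^ 2)))
         refl z ρ σ f₀ f₁)
        (null _ z³f₁+1≈σf₀ ⊹ null _ f₀σκ≈z-1 ⊹ null _ ρσ≈z³ ⊹ null _ z³ρ+σ))))

  -- V stands for G(u) + 1.
  module Evaluation
    {z ρ σ f₀ f₁ : Carrier}
    (ρσ≈z³ : ρ * σ ≈ z ^ 3) (z³f₁+1≈σf₀ : z ^ 3 * f₁ + 1# ≈ σ * f₀)
    (zf₁σ+z²f₀σ : z * f₁ * σ + z ^ 2 * f₀ * σ ≈ z ^ 3 * f₀ + z * (ρ + z))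
    {u F V : Carrier} (V-eq : V ≈ f₀ + u * (ρ * V))
    (F-eq : F ≈ f₀ + (u * (z * f₁) + (u * (z * (z * V)) + u * (u * (z * V))))) where

    -- Multiply `(1 - u ρ) V = f₀` by `- σ` and use `ρσ≈z³`.
    V-closed : V * (z ^ 3 * u - σ) ≈ - (σ * f₀)
    V-closed = combination
      (solve 6 (λ z r s f₀ u v → v :* (z :^ 3 :* u :- s) :- :- (s :* f₀) :=
         :- s :* (v :- (f₀ :+ u :* (r :* v))) :+ :- (u :* v) :* (r :* s :- z :^ 3))
       refl z ρ σ f₀ u V)
      (null _ V-eq ⊹ null _ ρσ≈z³)

    -- Multiplying `F-eq` by `z³ u - σ` clears `V` and leaves a quadratic polynomial in `u`. The
    -- coefficient of `u²` is simplified by `z³f₁+1≈σf₀`, that of `u` by `zf₁σ+z²f₀σ`.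
    F-closed : F * (z ^ 3 * u - σ) ≈ - (z * u ^ 2) - u * (z * (ρ + z)) - f₀ * σ
    F-closed = combination
      (solve 8 (λ z r s f₀ f₁ u F v →
         F :* (z :^ 3 :* u :- s) :- (:- (z :* u :^ 2) :- u :* (z :* (r :+ z)) :- f₀ :* s) :=
         (z :^ 3 :* u :- s) :* (F :- (f₀ :+ (u :* (z :* f₁) :+ (u :* (z :* (z :* v)) :+ u :* (u :* (z :* v))))))
         :+ (u :* z :^ 2 :+ u :^ 2 :* z) :* (v :* (z :^ 3 :* u :- s) :- :- (s :* f₀))
         :+ z :* u :^ 2 :* (z :^ 3 :* f₁ :+ con (+ 1) :- s :* f₀)
         :+ :- u :* (z :* f₁ :* s :+ z :^ 2 :* f₀ :* s :- (z :^ 3 :* f₀ :+ z :* (r :+ z))))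
       refl z ρ σ f₀ f₁ u F V)
      (null _ F-eq ⊹ null _ V-closed ⊹ null _ z³f₁+1≈σf₀ ⊹ null _ zf₁σ+z²f₀σ)

    -- As rs = 1, the inverse of u - s is - r q with q = 1 / (1 - r u).
    module Quotients {s z⁻¹ q G H} (zz⁻¹ : z * z⁻¹ ≈ 1#) (z³s : z ^ 3 * s ≈ σ) (ρs≈1 : ρ * s ≈ 1#)
      (q-eq : q ≈ 1# + u * (ρ * q)) (V≈1+G : V ≈ 1# + G) (H≈F+G : H ≈ F + G) where

      denominator : Carrier
      denominator = z ^ 2 * (u - s)

      denominator-inverse : - (z⁻¹ ^ 2 * (ρ * q)) * denominator ≈ 1#
      denominator-inverse = combination
        (solve 6 (λ z y r s u q → :- (y :^ 2 :* (r :* q)) :* (z :^ 2 :* (u :- s)) :- con (+ 1) :=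
           :- (r :* q :* (u :- s) :* (z :* y :+ con (+ 1))) :* (z :* y :- con (+ 1))
           :+ q :* (r :* s :- con (+ 1)) :+ con (+ 1) :* (q :- (con (+ 1) :+ u :* (r :* q))))
         refl z z⁻¹ ρ s u q)
        (null _ zz⁻¹ ⊹ null _ ρs≈1 ⊹ null _ q-eq)

      -- Since `z³ u - σ = z³ (u - s)`, this is `F-closed` divided by `z`, whence the multiplier
      -- `y = z⁻¹`. The summand with `z y - 1` accounts for replacing `z y l` by `l`.
      F*denominator : F * denominator ≈ - (u ^ 2) - u * (ρ + z) - z ^ 2 * f₀ * s
      F*denominator = combination
        (solve 8 (λ z y r s t f₀ u F →
           let l = F :* (z :^ 2 :* (u :- s)) :- (:- (u :^ 2) :- u :* (r :+ z) :- z :^ 2 :* f₀ :* s) in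
           l := y :* (F :* (z :^ 3 :* u :- t) :- (:- (z :* u :^ 2) :- u :* (z :* (r :+ z)) :- f₀ :* t))
             :+ y :* (f₀ :- F) :* (z :^ 3 :* s :- t) :+ :- l :* (z :* y :- con (+ 1)))
         refl z z⁻¹ ρ s σ f₀ u F)
        (null _ F-closed ⊹ null _ z³s ⊹ null _ zz⁻¹)

      G*denominator : G * denominator ≈ - (z ^ 2 * u) - z ^ 2 * f₀ * s + z ^ 2 * s
      G*denominator = combination
        (solve 8 (λ z y s t f₀ u G v →
           let l = G :* (z :^ 2 :* (u :- s)) :- (:- (z :^ 2 :* u) :- z :^ 2 :* f₀ :* s :+ z :^ 2 :* s) in
           l := y :* (v :* (z :^ 3 :* u :- t) :- :- (t :* f₀))
             :+ y :* (f₀ :- v) :* (z :^ 3 :* s :- t)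
             :+ :- (z :^ 2 :* (u :- s)) :* (v :- (con (+ 1) :+ G))
             :+ :- (v :* (z :^ 2 :* (u :- s)) :+ z :^ 2 :* f₀ :* s) :* (z :* y :- con (+ 1)))
         refl z z⁻¹ s σ f₀ u G V)
        (null _ V-closed ⊹ null _ z³s ⊹ null _ V≈1+G ⊹ null _ zz⁻¹)

      H*denominator : H * denominator ≈ - (u ^ 2 + u * (ρ + z + z ^ 2) + z ^ 2 * s * (2# * f₀ - 1#))
      H*denominator = combination
        (solve 8 (λ z r s f₀ u F G H →
           let d = z :^ 2 :* (u :- s) ; 1′ = con (+ 1) in
           H :* d :- :- (u :^ 2 :+ u :* (r :+ z :+ z :^ 2) :+ z :^ 2 :* s :* ((1′ :+ 1′) :* f₀ :- 1′)) :=
           d :* (H :- (F :+ G)) :+ 1′ :* (F :* d :- (:- (u :^ 2) :- u :* (r :+ z) :- z :^ 2 :* f₀ :* s))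
           :+ 1′ :* (G :* d :- (:- (z :^ 2 :* u) :- z :^ 2 :* f₀ :* s :+ z :^ 2 :* s)))
         refl z ρ s f₀ u F G H)
        (null _ H≈F+G ⊹ null _ F*denominator ⊹ null _ G*denominator)

      F-quotient : F ≈ (- (u ^ 2) - u * (ρ + z) - z ^ 2 * f₀ * s) / denominator
      F-quotient = quotient _ denominator-inverse F*denominator

      G-quotient : G ≈ (- (z ^ 2 * u) - z ^ 2 * f₀ * s + z ^ 2 * s) / denominator
      G-quotient = quotient _ denominator-inverse G*denominator

      H-quotient : H ≈ - (u ^ 2 + u * (ρ + z + z ^ 2) + z ^ 2 * s * (2# * f₀ - 1#)) / denominator
      H-quotient = quotient _ denominator-inverse H*denominator

  -- The case u = 1 of Evaluation, with v = 1 / (1 - z² - 2z³ - z⁴) because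
  -- (1 - ρ) (z³ - σ) = - (1 - z² - 2z³ - z⁴).
  module Total
    {z ρ σ f₀ f₁ f₂ h₀ h₁ h₂ T v : Carrier}
    (ρσ≈z³ : ρ * σ ≈ z ^ 3) (z³ρ+σ : z ^ 3 * ρ + σ ≈ 1# - z ^ 4 - z ^ 2)
    (z³f₁+1≈σf₀ : z ^ 3 * f₁ + 1# ≈ σ * f₀)
    (zf₁σ+z²f₀σ : z * f₁ * σ + z ^ 2 * f₀ * σ ≈ z ^ 3 * f₀ + z * (ρ + z))
    (f₁-eq : f₁ ≈ z * f₁ + z * (z * f₀)) (f₂-eq : f₂ ≈ z * f₀ + z * (z * (ρ * f₀)))
    (h₀-eq : h₀ + 1# ≈ f₀ + f₀) (h₁-eq : h₁ ≈ f₁ + ρ * f₀) (h₂-eq : h₂ ≈ f₂ + ρ * (ρ * f₀))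
    (T-eq : T - h₀ - h₁ - h₂ ≈ ρ * (T - h₀ - h₁))
    (v-eq : v ≈ 1# + z * (z * (v + (z * v + z * (v + z * v))))) where

    z³-σ-inverse : - ((1# - ρ) * v) * (z ^ 3 - σ) ≈ 1#
    z³-σ-inverse = combination
      (solve 4 (λ z r s v → :- ((con (+ 1) :- r) :* v) :* (z :^ 3 :- s) :- con (+ 1) :=
         con (+ 1) :* (v :- (con (+ 1) :+ z :* (z :* (v :+ (z :* v :+ z :* (v :+ z :* v))))))
         :+ :- v :* (r :* s :- z :^ 3)
         :+ v :* (z :^ 3 :* r :+ s :- (con (+ 1) :- z :^ 4 :- z :^ 2)))
       refl z ρ σ v)
      (null _ v-eq ⊹ null _ ρσ≈z³ ⊹ null _ z³ρ+σ)

    -- The factorisation that inverts `z³ - σ` inverts `1 - ρ` too.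
    y : Carrier
    y = - v * (z ^ 3 - σ)

    y-inverse : y * (1# - ρ) ≈ 1#
    y-inverse = trans (solve 4 (λ z r s v → :- v :* (z :^ 3 :- s) :* (con (+ 1) :- r) :=
      :- ((con (+ 1) :- r) :* v) :* (z :^ 3 :- s)) refl z ρ σ v) z³-σ-inverse

    -- `Γ` and `Φ` play the parts of `1 + G` and `F` at `u = 1`: `Γ = f₀ / (1 - ρ)` solves `V-eq`
    -- there, and `Φ` is the right-hand side of `F-eq`. The factors `1#` are kept so that `F-eq`
    -- holds by `refl`.
    Φ Γ : Carrier
    Γ = y * f₀
    Φ = f₀ + (1# * (z * f₁) + (1# * (z * (z * Γ)) + 1# * (1# * (z * Γ))))

    Γ-eq : Γ ≈ f₀ + 1# * (ρ * Γ)
    Γ-eq = combination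
      (solve 3 (λ r f₀ y → y :* f₀ :- (f₀ :+ con (+ 1) :* (r :* (y :* f₀))) :=
         f₀ :* (y :* (con (+ 1) :- r) :- con (+ 1)))
       refl ρ f₀ y)
      (null _ y-inverse)

    open Evaluation ρσ≈z³ z³f₁+1≈σf₀ zf₁σ+z²f₀σ {1#} {Φ} {Γ} Γ-eq refl

    -- `T-eq` is the summation of a geometric progression starting at `h₂`, namely
    -- `(1 - ρ)(T - h₀ - h₁) = h₂`. The term `- 1#` corrects for the empty path, which both `Φ` and
    -- `Γ` include.
    [1-ρ]T : (1# - ρ) * T ≈ (1# - ρ) * (Φ + Γ - 1#)
    [1-ρ]T = combination
      (solve 10 (λ z r f₀ f₁ f₂ h₀ h₁ h₂ T y →
         let 1′ = con (+ 1)
             Γ = y :* f₀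
             Φ = f₀ :+ (1′ :* (z :* f₁) :+ (1′ :* (z :* (z :* Γ)) :+ 1′ :* (1′ :* (z :* Γ)))) in
         (1′ :- r) :* T :- (1′ :- r) :* (Φ :+ Γ :- 1′) :=
         1′ :* (T :- h₀ :- h₁ :- h₂ :- r :* (T :- h₀ :- h₁))
         :+ (1′ :- r) :* (h₀ :+ 1′ :- (f₀ :+ f₀))
         :+ (1′ :- r) :* (h₁ :- (f₁ :+ r :* f₀))
         :+ 1′ :* (h₂ :- (f₂ :+ r :* (r :* f₀)))
         :+ 1′ :* (f₂ :- (z :* f₀ :+ z :* (z :* (r :* f₀))))
         :+ (1′ :- r) :* (f₁ :- (z :* f₁ :+ z :* (z :* f₀)))
         :+ :- ((z :^ 2 :+ z :+ 1′) :* f₀) :* (y :* (1′ :- r) :- 1′))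
       refl z ρ f₀ f₁ f₂ h₀ h₁ h₂ T y)
      (null _ T-eq ⊹ null _ h₀-eq ⊹ null _ h₁-eq ⊹ null _ h₂-eq ⊹ null _ f₂-eq ⊹ null _ f₁-eq ⊹ null _ y-inverse)

    -- Once `y` has cancelled `1 - ρ`, this is the sum of `F-closed` and `V-closed` at `u = 1`,
    -- minus `z³ - σ` for the doubly counted empty path.
    T-closed : T * (z ^ 3 - σ) ≈ - (z * (1# + ρ + z + z ^ 2) + σ * (2# * f₀ - 1#))
    T-closed = combination
      (solve 8 (λ z r s f₀ T y Φ Γ →
         let 1′ = con (+ 1) in
         T :* (z :^ 3 :- s) :- :- (z :* (1′ :+ r :+ z :+ z :^ 2) :+ s :* ((1′ :+ 1′) :* f₀ :- 1′)) :=
         (z :^ 3 :- s) :* y :* ((1′ :- r) :* T :- (1′ :- r) :* (Φ :+ Γ :- 1′))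
         :+ :- ((z :^ 3 :- s) :* (T :- (Φ :+ Γ :- 1′))) :* (y :* (1′ :- r) :- 1′)
         :+ 1′ :* (Φ :* (z :^ 3 :* 1′ :- s) :- (:- (z :* 1′ :^ 2) :- 1′ :* (z :* (r :+ z)) :- f₀ :* s))
         :+ 1′ :* (Γ :* (z :^ 3 :* 1′ :- s) :- :- (s :* f₀)))
       refl z ρ σ f₀ T y Φ Γ)
      (null _ [1-ρ]T ⊹ null _ y-inverse ⊹ null _ F-closed ⊹ null _ V-closed)

  module ScalarQuotients
    {z r s σ z⁻¹ f₀ : Carrier}
    (zz⁻¹ : z * z⁻¹ ≈ 1#) (z³s : z ^ 3 * s ≈ σ) (rs≈1 : r * s ≈ 1#) where

    -- Multiplying `f₀ σ κ = z - 1` by `r` trades `σ` for `z³`, because `r σ = z³ r s = z³`. The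
    -- same equation, read as `f₀ s (z³ κ) = z - 1`, supplies the inverse of `z³ κ`.
    f₀-quotient : ∀ {e} → e * (1# - z) ≈ 1# → f₀ * σ * (r * z ^ 2 + z - 1#) ≈ z - 1# →
      f₀ ≈ (r * (z - 1#)) / (z ^ 3 * (r * z ^ 2 + z - 1#))
    f₀-quotient {e} e-inverse f₀σκ = quotient (- (f₀ * s * e))
      (combination
        (solve 6 (λ z s t e f₀ k → :- (f₀ :* s :* e) :* (z :^ 3 :* k) :- con (+ 1) :=
           :- e :* (f₀ :* t :* k :- (z :- con (+ 1)))
           :+ :- (f₀ :* e :* k) :* (z :^ 3 :* s :- t)
           :+ con (+ 1) :* (e :* (con (+ 1) :- z) :- con (+ 1)))
         refl z s σ e f₀ κ)
        (null _ f₀σκ ⊹ null _ z³s ⊹ null _ e-inverse))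
      (combination
        (solve 6 (λ z r s t f₀ k → f₀ :* (z :^ 3 :* k) :- r :* (z :- con (+ 1)) :=
           r :* (f₀ :* t :* k :- (z :- con (+ 1)))
           :+ r :* f₀ :* k :* (z :^ 3 :* s :- t)
           :+ :- (z :^ 3 :* f₀ :* k) :* (r :* s :- con (+ 1)))
         refl z r s σ f₀ κ)
        (null _ f₀σκ ⊹ null _ z³s ⊹ null _ rs≈1))
      where κ = r * z ^ 2 + z - 1#

    -- As `z³ - σ = z (z² (1 - s))`, an inverse `d` of the left-hand side gives the inverse `d * z`
    -- of the required denominator.
    T-quotient : ∀ {T d} → d * (z ^ 3 - σ) ≈ 1# →
      T * (z ^ 3 - σ) ≈ - (z * (1# + r + z + z ^ 2) + σ * (2# * f₀ - 1#)) →
      T ≈ - (1# + r + z + z ^ 2 + z ^ 2 * s * (2# * f₀ - 1#)) / (z ^ 2 * (1# - s))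
    T-quotient {T} {d} d-inverse T-closed = quotient (d * z)
      (combination
        (solve 4 (λ z s t d → d :* z :* (z :^ 2 :* (con (+ 1) :- s)) :- con (+ 1) :=
           con (+ 1) :* (d :* (z :^ 3 :- t) :- con (+ 1)) :+ :- d :* (z :^ 3 :* s :- t))
         refl z s σ d)
        (null _ d-inverse ⊹ null _ z³s))
      (combination
        (solve 7 (λ z y r s t f₀ T →
           let 1′ = con (+ 1)
               l = T :* (z :^ 2 :* (1′ :- s)) :-
                   :- (1′ :+ r :+ z :+ z :^ 2 :+ z :^ 2 :* s :* ((1′ :+ 1′) :* f₀ :- 1′)) in
           l := y :* (T :* (z :^ 3 :- t) :- :- (z :* (1′ :+ r :+ z :+ z :^ 2) :+ t :* ((1′ :+ 1′) :* f₀ :- 1′)))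
             :+ y :* ((1′ :+ 1′) :* f₀ :- 1′ :- T) :* (z :^ 3 :* s :- t)
             :+ :- l :* (z :* y :- 1′))
         refl z z⁻¹ r s σ f₀ T)
        (null _ T-closed ⊹ null _ z³s ⊹ null _ zz⁻¹))

  cube-* : ∀ z x → z ^ 3 * x ≈ z * (z * (z * x))
  cube-* = solve 2 (λ z x → z :^ 3 :* x := z :* (z :* (z :* x))) refl

  cancel-z³-product : ∀ {z ρ σ r} → (∀ {x y} → z ^ 3 * x ≈ z ^ 3 * y → x ≈ y) →
    r ≈ z ^ 3 * ρ → r * σ ≈ z ^ 6 → ρ * σ ≈ z ^ 3
  cancel-z³-product {z} {ρ} {σ} {r} cancel r≈z³ρ rσ≈z⁶ = cancel (combination
    (solve 4 (λ z r s t → z :^ 3 :* (r :* s) :- z :^ 3 :* z :^ 3 :=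
       :- s :* (t :- z :^ 3 :* r) :+ con (+ 1) :* (t :* s :- z :^ 6))
     refl z ρ σ r)
    (null _ r≈z³ρ ⊹ null _ rσ≈z⁶))

  inverse-of-1- : ∀ {z e} → e ≈ 1# + z * e → e * (1# - z) ≈ 1#
  inverse-of-1- {z} {e} e-eq = combination
    (solve 2 (λ z e → e :* (con (+ 1) :- z) :- con (+ 1) := con (+ 1) :* (e :- (con (+ 1) :+ z :* e))) refl z e)
    (null _ e-eq)

  -- From index 2 on, `h k` is a fixed linear combination of `w` at `k - 2`, `k - 1` and `k`, so it
  -- inherits the ratio `ρ`. The expression would involve negative altitudes at the indices 0 and 1.
  h-geometric : ∀ {z ρ} {f g h w : ℕ → Carrier} →
    (∀ k → h k ≈ f k + g k) → (∀ k → w (suc k) ≈ g (suc k)) →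
    (∀ k → f (suc (suc k)) ≈ z * w k + z * (z * w (suc k))) → (∀ k → w (suc k) ≈ ρ * w k) →
    ∀ k → h (3 ℕ.+ k) ≈ ρ * h (2 ℕ.+ k)
  h-geometric {z} {ρ} {f} {g} {h} {w} h≈f+g w≈g f-suc-suc w-suc k = begin
    h (3 ℕ.+ k)
      ≈⟨ h≈ (suc k) ⟩
    z * w (suc k) + z * (z * w (2 ℕ.+ k)) + w (3 ℕ.+ k)
      ≈⟨ +-cong (+-cong (*-congˡ (w-suc k)) (*-congˡ (*-congˡ (w-suc (suc k))))) (w-suc (2 ℕ.+ k)) ⟩
    z * (ρ * w k) + z * (z * (ρ * w (suc k))) + ρ * w (2 ℕ.+ k)
      ≈⟨ solve 5 (λ z r w₀ w₁ w₂ → z :* (r :* w₀) :+ z :* (z :* (r :* w₁)) :+ r :* w₂ :=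
                                   r :* (z :* w₀ :+ z :* (z :* w₁) :+ w₂)) refl z ρ _ _ _ ⟩
    ρ * (z * w k + z * (z * w (suc k)) + w (2 ℕ.+ k))
      ≈⟨ *-congˡ (h≈ k) ⟨
    ρ * h (2 ℕ.+ k) ∎
    where
    open SetoidReasoning setoid
    h≈ : ∀ k → h (2 ℕ.+ k) ≈ z * w k + z * (z * w (suc k)) + w (2 ℕ.+ k)
    h≈ k = trans (h≈f+g (2 ℕ.+ k)) (+-cong (f-suc-suc k) (sym (w≈g (suc k))))

  module _ {z half q : Carrier} (half+half : half + half ≈ 1#)
    (q² : q * q ≈ z ^ 8 - 2# * z ^ 6 - z ^ 4 - 2# * z ^ 2 + 1#) where

    sum-conjugates : half * (1# - z ^ 4 - z ^ 2 - q) + half * (1# - z ^ 4 - z ^ 2 + q) ≈ 1# - z ^ 4 - z ^ 2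
    sum-conjugates = combination
      (solve 3 (λ z h q → let 1′ = con (+ 1) ; a = 1′ :- z :^ 4 :- z :^ 2 in
         h :* (a :- q) :+ h :* (a :+ q) :- a := a :* (h :+ h :- 1′)) refl z half q)
      (null _ half+half)

    -- A difference of squares: `(1 - z⁴ - z²)²` exceeds the radicand by `4 z⁶`. This is `r s = 1`
    -- with denominators cleared.
    product-conjugates : half * (1# - z ^ 4 - z ^ 2 - q) * (half * (1# - z ^ 4 - z ^ 2 + q)) ≈ z ^ 6
    product-conjugates = combination
      (solve 3 (λ z h q → let 1′ = con (+ 1) ; 2′ = 1′ :+ 1′ ; a = 1′ :- z :^ 4 :- z :^ 2 in
         h :* (a :- q) :* (h :* (a :+ q)) :- z :^ 6 :=
         z :^ 6 :* (h :+ h :+ 1′) :* (h :+ h :- 1′)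
         :+ :- (h :* h) :* (q :* q :- (z :^ 8 :- 2′ :* z :^ 6 :- z :^ 4 :- 2′ :* z :^ 2 :+ 1′)))
       refl z half q)
      (null _ half+half ⊹ null _ q²)

  module InitialTerms
    {z ρ f₀ f₁ f₂ g₀ g₁ g₂ h₀ h₁ h₂ w₀ w₁ w₂ : Carrier}
    (w₀≈f₀ : w₀ ≈ f₀) (w₁≈ρw₀ : w₁ ≈ ρ * w₀) (w₂≈ρw₁ : w₂ ≈ ρ * w₁)
    (w₀≈1+g₀ : w₀ ≈ 1# + g₀) (w₁≈g₁ : w₁ ≈ g₁) (w₂≈g₂ : w₂ ≈ g₂)
    (h₀≈f₀+g₀ : h₀ ≈ f₀ + g₀) (h₁≈f₁+g₁ : h₁ ≈ f₁ + g₁) (h₂≈f₂+g₂ : h₂ ≈ f₂ + g₂) where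

    w₁≈ρf₀ : w₁ ≈ ρ * f₀
    w₁≈ρf₀ = trans w₁≈ρw₀ (*-congˡ w₀≈f₀)

    f₀-eq : w₀ ≈ 1# + (z * f₂ + z * (z * f₁)) → f₀ ≈ 1# + (z * f₂ + z * (z * f₁))
    f₀-eq = trans (sym w₀≈f₀)

    f₁-eq : f₁ ≈ z * f₁ + z * (z * w₀) → f₁ ≈ z * f₁ + z * (z * f₀)
    f₁-eq eq = trans eq (+-congˡ (*-congˡ (*-congˡ w₀≈f₀)))

    f₂-eq : f₂ ≈ z * w₀ + z * (z * w₁) → f₂ ≈ z * f₀ + z * (z * (ρ * f₀))
    f₂-eq eq = trans eq (+-cong (*-congˡ w₀≈f₀) (*-congˡ (*-congˡ w₁≈ρf₀)))

    -- The empty path is counted once in `h₀` but in both `f₀` and `w₀`, which are equal.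
    h₀-eq : h₀ + 1# ≈ f₀ + f₀
    h₀-eq = trans (+-congʳ h₀≈f₀+g₀) (trans (+-assoc f₀ g₀ 1#)
      (+-congˡ (trans (+-comm g₀ 1#) (trans (sym w₀≈1+g₀) w₀≈f₀))))

    h₁-eq : h₁ ≈ f₁ + ρ * f₀
    h₁-eq = trans h₁≈f₁+g₁ (+-congˡ (trans (sym w₁≈g₁) w₁≈ρf₀))

    h₂-eq : h₂ ≈ f₂ + ρ * (ρ * f₀)
    h₂-eq = trans h₂≈f₂+g₂ (+-congˡ (trans (sym w₂≈g₂) (trans w₂≈ρw₁ (*-congˡ w₁≈ρf₀))))

-- Transport to Laurent series and to power series in u

record Homomorphism {a ℓ b m} (From : RawRing a ℓ) (To : RawRing b m) : Set (a ⊔ ℓ ⊔ b ⊔ m) where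
  private
    module From = RawRing From
    module To = RawRing To
  field
    ⟦_⟧     : From.Carrier → To.Carrier
    ⟦⟧-cong : ∀ {x y} → x From.≈ y → ⟦ x ⟧ To.≈ ⟦ y ⟧
    +-homo  : ∀ x y → ⟦ x From.+ y ⟧ To.≈ ⟦ x ⟧ To.+ ⟦ y ⟧
    *-homo  : ∀ x y → ⟦ x From.* y ⟧ To.≈ ⟦ x ⟧ To.* ⟦ y ⟧
    -‿homo  : ∀ x → ⟦ From.- x ⟧ To.≈ To.- ⟦ x ⟧
    1#-homo : ⟦ From.1# ⟧ To.≈ To.1#

module Transport {a ℓ b m} (From : CommutativeRing a ℓ) (To : CommutativeRing b m)
  (φ : Homomorphism (CommutativeRing.rawRing From) (CommutativeRing.rawRing To)) where
  open Homomorphism φ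
  private
    module From = Arith (CommutativeRing.rawRing From)
    module To = Arith (CommutativeRing.rawRing To)
    open module ≈ = CommutativeRing To using (refl; sym; trans)

  -- A derivation of x ↦ y mirrors the expression x.
  infix 4 _↦_
  _↦_ : From.Carrier → To.Carrier → Set m
  x ↦ y = ⟦ x ⟧ To.≈ y

  refl-↦ : ∀ {x} → x ↦ ⟦ x ⟧
  refl-↦ = refl

  infixl 6 _⊕_ _⊖_
  infixl 7 _⊛_
  infixr 8 _⊛^_

  _⊕_ : ∀ {x y x′ y′} → x ↦ x′ → y ↦ y′ → x From.+ y ↦ x′ To.+ y′
  p ⊕ q = trans (+-homo _ _) (≈.+-cong p q)

  _⊛_ : ∀ {x y x′ y′} → x ↦ x′ → y ↦ y′ → x From.* y ↦ x′ To.* y′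
  p ⊛ q = trans (*-homo _ _) (≈.*-cong p q)

  ⊖_ : ∀ {x x′} → x ↦ x′ → From.- x ↦ To.- x′
  ⊖ p = trans (-‿homo _) (≈.-‿cong p)

  _⊖_ : ∀ {x y x′ y′} → x ↦ x′ → y ↦ y′ → x From.- y ↦ x′ To.- y′
  p ⊖ q = p ⊕ (⊖ q)

  _⊛^_ : ∀ {x x′} → x ↦ x′ → ∀ n → x From.^ n ↦ x′ To.^ n
  p ⊛^ zero  = 1#-homo
  p ⊛^ suc n = p ⊛ p ⊛^ n

  transport : ∀ {x y x′ y′} → x ↦ x′ → y ↦ y′ → x From.≈ y → x′ To.≈ y′
  transport p q x≈y = trans (sym p) (trans (⟦⟧-cong x≈y) q)

-- A record keeps the formulas from unfolding into nested convolution sums when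
-- the rings are instantiated.
record Formulas {b m} {L U : RawRing b m} (⟨_⟩ : RawRing.Carrier L → RawRing.Carrier U)
  (z r s f₀ T : RawRing.Carrier L) (u F G H : RawRing.Carrier U) : Set (b ⊔ m) where
  private
    module L = Arith L
    module U = Arith U
  field
    F-quotient : let open U in
      F ≈ (- (u ^ 2) - u * (⟨ r ⟩ + ⟨ z ⟩) - ⟨ z ⟩ ^ 2 * ⟨ f₀ ⟩ * ⟨ s ⟩) / (⟨ z ⟩ ^ 2 * (u - ⟨ s ⟩))
    G-quotient : let open U in
      G ≈ (- (⟨ z ⟩ ^ 2 * u) - ⟨ z ⟩ ^ 2 * ⟨ f₀ ⟩ * ⟨ s ⟩ + ⟨ z ⟩ ^ 2 * ⟨ s ⟩) / (⟨ z ⟩ ^ 2 * (u - ⟨ s ⟩))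
    H≈F+G : let open U in H ≈ F + G
    H-quotient : let open U in
      H ≈ - (u ^ 2 + u * (⟨ r ⟩ + ⟨ z ⟩ + ⟨ z ⟩ ^ 2) + ⟨ z ⟩ ^ 2 * ⟨ s ⟩ * (2# * ⟨ f₀ ⟩ - 1#))
        / (⟨ z ⟩ ^ 2 * (u - ⟨ s ⟩))
    f₀-quotient : let open L in f₀ ≈ (r * (z - 1#)) / (z ^ 3 * (r * z ^ 2 + z - 1#))
    T-quotient : let open L in
      T ≈ - (1# + r + z + z ^ 2 + z ^ 2 * s * (2# * f₀ - 1#)) / (z ^ 2 * (1# - s))

module Assembly {a ℓ b m} (S : CommutativeRing a ℓ) (L : CommutativeRing b m)
  (ι : Homomorphism (CommutativeRing.rawRing S) (CommutativeRing.rawRing L)) where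
  open PowerSeriesProperties L using (powerSeriesRing; X*-zero; X*-suc; constant-*)
  private
    module ι = Homomorphism ι
    module S = CommutativeRing S
    module S′ = Arith S.rawRing
    module L = CommutativeRing L
    module L′ = Arith L.rawRing
    module U = CommutativeRing powerSeriesRing
    module U′ = Arith U.rawRing
    open ι using (⟦_⟧)

  ⟨_⟩ : L.Carrier → U.Carrier
  ⟨_⟩ = constant L.rawRing

  u : U.Carrier
  u = indeterminate L.rawRing

  constant-homomorphism : Homomorphism L.rawRing U.rawRing
  constant-homomorphism = record
    { ⟦_⟧     = ⟨_⟩
    ; ⟦⟧-cong = λ { x≈y zero → x≈y ; x≈y (suc _) → L.refl }
    ; +-homo  = λ { x y zero → L.refl ; x y (suc _) → L.sym (L.+-identityˡ L.0#) }
    ; *-homo  = λ { x y zero    → L.sym (constant-* x ⟨ y ⟩ 0)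
                  ; x y (suc n) → L.sym (L.trans (constant-* x ⟨ y ⟩ (suc n)) (L.zeroʳ x)) }
    ; -‿homo  = λ { x zero → L.refl ; x (suc _) → L.sym -0#≈0# }
    ; 1#-homo = U.refl
    }
    where open RingProperties L.ring using (-0#≈0#)

  private
    module C = Transport L powerSeriesRing constant-homomorphism
    constant-cong = Homomorphism.⟦⟧-cong constant-homomorphism

  ⟨ι⟩ : Homomorphism S.rawRing U.rawRing
  ⟨ι⟩ = record
    { ⟦_⟧     = ⟨_⟩ ∘ ⟦_⟧
    ; ⟦⟧-cong = λ x≈y → constant-cong (ι.⟦⟧-cong x≈y)
    ; +-homo  = λ x y → U.trans (constant-cong (ι.+-homo x y)) (C.refl-↦ C.⊕ C.refl-↦)
    ; *-homo  = λ x y → U.trans (constant-cong (ι.*-homo x y)) (C.refl-↦ C.⊛ C.refl-↦)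
    ; -‿homo  = λ x → U.trans (constant-cong (ι.-‿homo x)) (C.⊖ C.refl-↦)
    ; 1#-homo = U.trans (constant-cong ι.1#-homo) U.refl
    }

  module _ {zₛ ρ σ : S.Carrier} {f g h w : ℕ → S.Carrier} {r s z z⁻¹ : L.Carrier}
    (zₛ↦z : ⟦ zₛ ⟧ L.≈ z) (ρ↦r : ⟦ ρ ⟧ L.≈ r) (σ↦z³s : ⟦ σ ⟧ L.≈ z L′.^ 3 L.* s)
    (rs≈1 : r L.* s L.≈ L.1#) (zz⁻¹≈1 : z L.* z⁻¹ L.≈ L.1#)
    (ρσ≈z³ : ρ S.* σ S.≈ zₛ S′.^ 3)
    (z³f₁+1≈σf₀ : zₛ S′.^ 3 S.* f 1 S.+ S.1# S.≈ σ S.* f 0)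
    (zf₁σ+z²f₀σ : zₛ S.* f 1 S.* σ S.+ zₛ S′.^ 2 S.* f 0 S.* σ S.≈ zₛ S′.^ 3 S.* f 0 S.+ zₛ S.* (ρ S.+ zₛ))
    where

    module Bivariate
      (w₀≈f₀ : w 0 S.≈ f 0) (w-suc : ∀ k → w (suc k) S.≈ ρ S.* w k)
      (f₁-eq : f 1 S.≈ zₛ S.* f 1 S.+ zₛ S.* (zₛ S.* w 0))
      (f-suc-suc : ∀ k → f (suc (suc k)) S.≈ zₛ S.* w k S.+ zₛ S.* (zₛ S.* w (suc k)))
      (w₀≈1+g₀ : w 0 S.≈ S.1# S.+ g 0) (w-suc≈g-suc : ∀ k → w (suc k) S.≈ g (suc k))
      (h≈f+g : ∀ k → h k S.≈ f k S.+ g k) where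

      F G H V q : U.Carrier
      F k = ⟦ f k ⟧
      G k = ⟦ g k ⟧
      H k = ⟦ h k ⟧
      V k = ⟦ w k ⟧
      q k = r L′.^ k

      private module T = Transport S L ι
      open T using (_⊕_; _⊛_)

      drop-0ˡ : ∀ {x y y′} → x L.≈ L.0# → y L.≈ y′ → x L.+ y L.≈ y′
      drop-0ˡ x≈0 y≈y′ = L.trans (L.+-cong x≈0 y≈y′) (L.+-identityˡ _)

      drop-0ʳ : ∀ {x y x′} → x L.≈ x′ → y L.≈ L.0# → x L.+ y L.≈ x′
      drop-0ʳ x≈x′ y≈0 = L.trans (L.+-cong x≈x′ y≈0) (L.+-identityʳ _)

      V-eq : V U.≈ ⟨ ⟦ f 0 ⟧ ⟩ U.+ u U.* (⟨ r ⟩ U.* V)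
      V-eq zero    = L.sym (drop-0ʳ (L.sym (ι.⟦⟧-cong w₀≈f₀)) (X*-zero (⟨ r ⟩ U.* V)))
      V-eq (suc k) = L.sym (drop-0ˡ L.refl (L.trans (X*-suc (⟨ r ⟩ U.* V) k) (L.trans (constant-* r V k)
        (T.transport (ρ↦r ⊛ L.refl) L.refl (S.sym (w-suc k))))))

      q-eq : q U.≈ U.1# U.+ u U.* (⟨ r ⟩ U.* q)
      q-eq zero    = L.sym (drop-0ʳ L.refl (X*-zero (⟨ r ⟩ U.* q)))
      q-eq (suc k) = L.sym (drop-0ˡ L.refl (L.trans (X*-suc (⟨ r ⟩ U.* q) k) (constant-* r q k)))

      private
        zf₁ zV zzV uzV : U.Carrier
        zf₁ = ⟨ z ⟩ U.* ⟨ ⟦ f 1 ⟧ ⟩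
        zV  = ⟨ z ⟩ U.* V
        zzV = ⟨ z ⟩ U.* zV
        uzV = u U.* zV

      zzV-coefficient : ∀ k → zzV k L.≈ z L.* (z L.* V k)
      zzV-coefficient k = L.trans (constant-* z zV k) (L.*-congˡ (constant-* z V k))

      -- The terms `u z² V` and `u² z V` record a last step `E` or `N` taken from a non-negative
      -- altitude. The term `u z f₁` is a last step `N` from altitude -1, where reflection replaces
      -- the paths ending down by those counted in `f 1`.
      F-eq : F U.≈ ⟨ ⟦ f 0 ⟧ ⟩ U.+ (u U.* (⟨ z ⟩ U.* ⟨ ⟦ f 1 ⟧ ⟩) U.+
        (u U.* (⟨ z ⟩ U.* (⟨ z ⟩ U.* V)) U.+ u U.* (u U.* (⟨ z ⟩ U.* V))))
      F-eq zero = L.sym (drop-0ʳ L.refl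
        (drop-0ˡ (X*-zero zf₁) (drop-0ˡ (X*-zero zzV) (X*-zero uzV))))
      F-eq (suc zero) = L.sym (drop-0ˡ L.refl (L.trans
        (L.+-cong (L.trans (X*-suc zf₁ 0) (constant-* z ⟨ ⟦ f 1 ⟧ ⟩ 0))
          (drop-0ʳ (L.trans (X*-suc zzV 0) (zzV-coefficient 0)) (L.trans (X*-suc uzV 0) (X*-zero zV))))
        (T.transport (zₛ↦z ⊛ L.refl ⊕ zₛ↦z ⊛ (zₛ↦z ⊛ L.refl)) L.refl (S.sym f₁-eq))))
      F-eq (suc (suc k)) = L.sym (drop-0ˡ L.refl (drop-0ˡ
        (L.trans (X*-suc zf₁ (suc k)) (L.trans (constant-* z ⟨ ⟦ f 1 ⟧ ⟩ (suc k)) (L.zeroʳ z)))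
        (L.trans
          (L.+-cong (L.trans (X*-suc zzV (suc k)) (zzV-coefficient (suc k)))
            (L.trans (X*-suc uzV (suc k)) (L.trans (X*-suc zV k) (constant-* z V k))))
          (L.trans (L.+-comm _ _)
            (T.transport (zₛ↦z ⊛ L.refl ⊕ zₛ↦z ⊛ (zₛ↦z ⊛ L.refl)) L.refl (S.sym (f-suc-suc k)))))))

      V≈1+G : V U.≈ U.1# U.+ G
      V≈1+G zero    = L.trans (ι.⟦⟧-cong w₀≈1+g₀) (ι.1#-homo ⊕ L.refl)
      V≈1+G (suc k) = L.trans (ι.⟦⟧-cong (w-suc≈g-suc k)) (L.sym (L.+-identityˡ _))

      H≈F+G : H U.≈ F U.+ G
      H≈F+G k = L.trans (ι.⟦⟧-cong (h≈f+g k)) (ι.+-homo _ _)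

      private module T′ = Transport S powerSeriesRing ⟨ι⟩

      zₛ↦⟨z⟩ : ⟨ ⟦ zₛ ⟧ ⟩ U.≈ ⟨ z ⟩
      zₛ↦⟨z⟩ = constant-cong zₛ↦z
      ρ↦⟨r⟩ : ⟨ ⟦ ρ ⟧ ⟩ U.≈ ⟨ r ⟩
      ρ↦⟨r⟩ = constant-cong ρ↦r

      open RingIdentities.Evaluation powerSeriesRing {⟨ z ⟩} {⟨ r ⟩} {⟨ ⟦ σ ⟧ ⟩} {⟨ ⟦ f 0 ⟧ ⟩} {⟨ ⟦ f 1 ⟧ ⟩}
        (T′.transport (ρ↦⟨r⟩ T′.⊛ U.refl) (zₛ↦⟨z⟩ T′.⊛^ 3) ρσ≈z³)
        (T′.transport (zₛ↦⟨z⟩ T′.⊛^ 3 T′.⊛ U.refl T′.⊕ Homomorphism.1#-homo ⟨ι⟩) (U.refl T′.⊛ U.refl) z³f₁+1≈σf₀)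
        (T′.transport (zₛ↦⟨z⟩ T′.⊛ U.refl T′.⊛ U.refl T′.⊕ zₛ↦⟨z⟩ T′.⊛^ 2 T′.⊛ U.refl T′.⊛ U.refl)
          (zₛ↦⟨z⟩ T′.⊛^ 3 T′.⊛ U.refl T′.⊕ zₛ↦⟨z⟩ T′.⊛ (ρ↦⟨r⟩ T′.⊕ zₛ↦⟨z⟩)) zf₁σ+z²f₀σ)
        {u} {F} {V} V-eq F-eq
        using (module Quotients)
      open Quotients {⟨ s ⟩} {⟨ z⁻¹ ⟩} {q} {G} {H}
        (C.transport (U.refl C.⊛ U.refl) U.refl zz⁻¹≈1)
        (C.transport (U.refl C.⊛^ 3 C.⊛ U.refl) U.refl (L.sym σ↦z³s))
        (C.transport (U.refl C.⊛ U.refl) U.refl rs≈1)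
        q-eq V≈1+G H≈F+G public
        using (F-quotient; G-quotient; H-quotient)

    module Univariate {e d T : S.Carrier} (e-inverse : e S.* (S.1# S′.- zₛ) S.≈ S.1#)
      (f₀σκ : f 0 S.* σ S.* (ρ S.* zₛ S′.^ 2 S.+ zₛ S′.- S.1#) S.≈ zₛ S′.- S.1#)
      (d-inverse : d S.* (zₛ S′.^ 3 S′.- σ) S.≈ S.1#)
      (T-closed : T S.* (zₛ S′.^ 3 S′.- σ) S.≈
        S.- (zₛ S.* (S.1# S.+ ρ S.+ zₛ S.+ zₛ S′.^ 2) S.+ σ S.* (S′.2# S.* f 0 S′.- S.1#))) where

      open Transport S L ι
      open RingIdentities.ScalarQuotients L {z} {r} {s} {⟦ σ ⟧} {z⁻¹} {⟦ f 0 ⟧} zz⁻¹≈1 (L.sym σ↦z³s) rs≈1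
        renaming (f₀-quotient to f₀-quotient′; T-quotient to T-quotient′)

      private
        1↦ : S.1# ↦ L.1#
        1↦ = ι.1#-homo

      f₀-quotient : ⟦ f 0 ⟧ L′.≈ (r L.* (z L′.- L.1#)) / (z L′.^ 3 L.* (r L.* z L′.^ 2 L.+ z L′.- L.1#))
      f₀-quotient = f₀-quotient′ {⟦ e ⟧}
        (transport (L.refl ⊛ (1↦ ⊖ zₛ↦z)) 1↦ e-inverse)
        (transport (L.refl ⊛ L.refl ⊛ (ρ↦r ⊛ zₛ↦z ⊛^ 2 ⊕ zₛ↦z ⊖ 1↦)) (zₛ↦z ⊖ 1↦) f₀σκ)
        where open L′ using (_≈_/_)

      T-quotient : ⟦ T ⟧ L′.≈ L.- (L.1# L.+ r L.+ z L.+ z L′.^ 2 L.+ z L′.^ 2 L.* s L.* (L′.2# L.* ⟦ f 0 ⟧ L′.- L.1#))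
        / (z L′.^ 2 L.* (L.1# L′.- s))
      T-quotient = T-quotient′ {⟦ T ⟧} {⟦ d ⟧}
        (transport (L.refl ⊛ (zₛ↦z ⊛^ 3 ⊖ L.refl)) 1↦ d-inverse)
        (transport (L.refl ⊛ (zₛ↦z ⊛^ 3 ⊖ L.refl))
          (⊖ (zₛ↦z ⊛ (1↦ ⊕ ρ↦r ⊕ zₛ↦z ⊕ zₛ↦z ⊛^ 2) ⊕ L.refl ⊛ ((1↦ ⊕ 1↦) ⊛ L.refl ⊖ 1↦))) T-closed)

-- The theorem for abstract rings and sequences

module Solution {a ℓ b m} (S : CommutativeRing a ℓ) (L : CommutativeRing b m)
  (ι : Homomorphism (CommutativeRing.rawRing S) (CommutativeRing.rawRing L)) where
  open CommutativeRing S hiding (_-_)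
  open Arith rawRing using (_^_; _-_)
  private
    module L = CommutativeRing L
    module L′ = Arith L.rawRing
    open Homomorphism ι using (⟦_⟧)

  module _
    {zₛ ρ σ e v T : Carrier} {f g h w : ℕ → Carrier}
    (zₛ*-cancel : ∀ {x y} → zₛ * x ≈ zₛ * y → x ≈ y)
    (ρσ≈z³ : ρ * σ ≈ zₛ ^ 3) (z³ρ+σ : zₛ ^ 3 * ρ + σ ≈ 1# - zₛ ^ 4 - zₛ ^ 2)
    (e-eq : e ≈ 1# + zₛ * e)
    (v-eq : v ≈ 1# + zₛ * (zₛ * (v + (zₛ * v + zₛ * (v + zₛ * v)))))
    (w₀≈f₀ : w 0 ≈ f 0) (w-suc : ∀ k → w (suc k) ≈ ρ * w k)
    (w₀-eq : w 0 ≈ 1# + (zₛ * f 2 + zₛ * (zₛ * f 1)))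
    (w₀≈1+g₀ : w 0 ≈ 1# + g 0) (w-suc≈g-suc : ∀ k → w (suc k) ≈ g (suc k))
    (f₁-eq : f 1 ≈ zₛ * f 1 + zₛ * (zₛ * w 0))
    (f-suc-suc : ∀ k → f (suc (suc k)) ≈ zₛ * w k + zₛ * (zₛ * w (suc k)))
    (h≈f+g : ∀ k → h k ≈ f k + g k)
    (T-eq : T - h 0 - h 1 - h 2 ≈ ρ * (T - h 0 - h 1))
    where

    private
      module Initial = RingIdentities.InitialTerms S {zₛ} {ρ} {f 0} {f 1} {f 2} {g 0} {g 1} {g 2} {h 0} {h 1} {h 2} {w 0} {w 1} {w 2}
        w₀≈f₀ (w-suc 0) (w-suc 1) w₀≈1+g₀ (w-suc≈g-suc 0) (w-suc≈g-suc 1) (h≈f+g 0) (h≈f+g 1) (h≈f+g 2)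

      e-inverse : e * (1# - zₛ) ≈ 1#
      e-inverse = RingIdentities.inverse-of-1- S e-eq

      open RingIdentities.Kernel.Scalar S {zₛ} {ρ} {σ} ρσ≈z³ z³ρ+σ {f 0} {f 1} {f 2} zₛ*-cancel {e} e-inverse
        (Initial.f₁-eq f₁-eq) (Initial.f₂-eq (f-suc-suc 0)) (Initial.f₀-eq w₀-eq)

      open RingIdentities.Total S {zₛ} {ρ} {σ} {f 0} {f 1} {f 2} {h 0} {h 1} {h 2} {T} {v} ρσ≈z³ z³ρ+σ z³f₁+1≈σf₀ zf₁σ+z²f₀σ
        (Initial.f₁-eq f₁-eq) (Initial.f₂-eq (f-suc-suc 0)) Initial.h₀-eq Initial.h₁-eq Initial.h₂-eq T-eq v-eq

    formulas : ∀ {r s z z⁻¹ : L.Carrier}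
      (zₛ↦z : ⟦ zₛ ⟧ L.≈ z) (ρ↦r : ⟦ ρ ⟧ L.≈ r) (σ↦z³s : ⟦ σ ⟧ L.≈ z L′.^ 3 L.* s)
      (rs≈1 : r L.* s L.≈ L.1#) (zz⁻¹≈1 : z L.* z⁻¹ L.≈ L.1#) →
      Formulas {L = L.rawRing} {PowerSeries L.rawRing} (constant L.rawRing) z r s ⟦ f 0 ⟧ ⟦ T ⟧
        (indeterminate L.rawRing) (λ k → ⟦ f k ⟧) (λ k → ⟦ g k ⟧) (λ k → ⟦ h k ⟧)
    formulas {r} {s} {z} {z⁻¹} zₛ↦z ρ↦r σ↦z³s rs≈1 zz⁻¹≈1 = record
      { F-quotient  = Biv.F-quotient
      ; G-quotient  = Biv.G-quotient
      ; H≈F+G       = Biv.H≈F+G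
      ; H-quotient  = Biv.H-quotient
      ; f₀-quotient = Uni.f₀-quotient
      ; T-quotient  = Uni.T-quotient
      }
      where
      module Biv = Assembly.Bivariate S L ι {zₛ} {ρ} {σ} {f} {g} {h} {w} {r} {s} {z} {z⁻¹} zₛ↦z ρ↦r σ↦z³s rs≈1 zz⁻¹≈1
        ρσ≈z³ z³f₁+1≈σf₀ zf₁σ+z²f₀σ w₀≈f₀ w-suc f₁-eq f-suc-suc w₀≈1+g₀ w-suc≈g-suc h≈f+g
      module Uni = Assembly.Univariate S L ι {zₛ} {ρ} {σ} {f} {g} {h} {w} {r} {s} {z} {z⁻¹} zₛ↦z ρ↦r σ↦z³s rs≈1 zz⁻¹≈1
        ρσ≈z³ z³f₁+1≈σf₀ zf₁σ+z²f₀σ {e} { - ((1# - ρ) * v)} {T} e-inverse f₀σκ≈z-1 z³-σ-inverse T-closed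

-- Laurent series as fractions

module Fractions {c ℓ} (R : CommutativeRing c ℓ) where
  open CommutativeRing R
  open Arith rawRing using (_^_)
  open Exp semiring using (^-homo-*)
  open IntegerSolver R
  open SetoidReasoning setoid

  module PowersOf (X : Carrier) (X*-cancel : ∀ a b → X * a ≈ X * b → a ≈ b) where

    X^*-cancel : ∀ n {a b} → X ^ n * a ≈ X ^ n * b → a ≈ b
    X^*-cancel zero    {a} {b} eq = trans (sym (*-identityˡ a)) (trans eq (*-identityˡ b))
    X^*-cancel (suc n) {a} {b} eq =
      X^*-cancel n (X*-cancel _ _ (trans (sym (*-assoc X _ a)) (trans eq (*-assoc X _ b))))

    private
      homo : ∀ m n → X ^ (m ℕ.+ n) ≈ X ^ m * X ^ n
      homo = ^-homo-* X

    ≈-intro : ∀ {a b m n} → a ≈ b → m ≡ n → X ^ n * a ≈ X ^ m * b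
    ≈-intro a≈b ≡.refl = *-congˡ a≈b

    -- Transitivity of cross-multiplication relies on `X` not being a zero divisor: the middle
    -- denominator `X ^ n` is introduced and then cancelled.
    ≈-trans : ∀ a b c {m n p} → X ^ n * a ≈ X ^ m * b → X ^ p * b ≈ X ^ n * c → X ^ p * a ≈ X ^ m * c
    ≈-trans a b c {m} {n} {p} eq₁ eq₂ = X^*-cancel n (begin
      X ^ n * (X ^ p * a) ≈⟨ swap _ _ a ⟩
      X ^ p * (X ^ n * a) ≈⟨ *-congˡ eq₁ ⟩
      X ^ p * (X ^ m * b) ≈⟨ swap _ _ b ⟩
      X ^ m * (X ^ p * b) ≈⟨ *-congˡ eq₂ ⟩
      X ^ m * (X ^ n * c) ≈⟨ swap _ _ c ⟩
      X ^ n * (X ^ m * c) ∎)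
      where
      swap : ∀ x y v → x * (y * v) ≈ y * (x * v)
      swap = solve 3 (λ x y v → x :* (y :* v) := y :* (x :* v)) refl

    -- The exponents are variables, so `homo` first splits the powers of sums; the solver then
    -- treats `X ^ m`, `X ^ n`, `X ^ p` and `X ^ q` as atoms. The other fraction laws with sums of
    -- exponents follow this pattern.
    +-cong-fraction : ∀ a b c d {m n p q} → X ^ n * a ≈ X ^ m * b → X ^ q * c ≈ X ^ p * d →
      X ^ (n ℕ.+ q) * (X ^ p * a + X ^ m * c) ≈ X ^ (m ℕ.+ p) * (X ^ q * b + X ^ n * d)
    +-cong-fraction a b c d {m} {n} {p} {q} eq₁ eq₂ = begin
      X ^ (n ℕ.+ q) * (X ^ p * a + X ^ m * c)
        ≈⟨ *-congʳ (homo n q) ⟩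
      X ^ n * X ^ q * (X ^ p * a + X ^ m * c)
        ≈⟨ solve 6 (λ m n p q a c → n :* q :* (p :* a :+ m :* c) := p :* q :* (n :* a) :+ m :* n :* (q :* c))
             refl (X ^ m) (X ^ n) (X ^ p) (X ^ q) a c ⟩
      X ^ p * X ^ q * (X ^ n * a) + X ^ m * X ^ n * (X ^ q * c)
        ≈⟨ +-cong (*-congˡ eq₁) (*-congˡ eq₂) ⟩
      X ^ p * X ^ q * (X ^ m * b) + X ^ m * X ^ n * (X ^ p * d)
        ≈⟨ solve 6 (λ m n p q b d → p :* q :* (m :* b) :+ m :* n :* (p :* d) := m :* p :* (q :* b :+ n :* d))
             refl (X ^ m) (X ^ n) (X ^ p) (X ^ q) b d ⟩
      X ^ m * X ^ p * (X ^ q * b + X ^ n * d)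
        ≈⟨ *-congʳ (homo m p) ⟨
      X ^ (m ℕ.+ p) * (X ^ q * b + X ^ n * d) ∎

    *-cong-fraction : ∀ a b c d {m n p q} → X ^ n * a ≈ X ^ m * b → X ^ q * c ≈ X ^ p * d →
      X ^ (n ℕ.+ q) * (a * c) ≈ X ^ (m ℕ.+ p) * (b * d)
    *-cong-fraction a b c d {m} {n} {p} {q} eq₁ eq₂ = begin
      X ^ (n ℕ.+ q) * (a * c)       ≈⟨ *-congʳ (homo n q) ⟩
      X ^ n * X ^ q * (a * c)       ≈⟨ interchange _ _ _ _ ⟩
      X ^ n * a * (X ^ q * c)       ≈⟨ *-cong eq₁ eq₂ ⟩
      X ^ m * b * (X ^ p * d)       ≈⟨ interchange _ _ _ _ ⟨
      X ^ m * X ^ p * (b * d)       ≈⟨ *-congʳ (homo m p) ⟨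
      X ^ (m ℕ.+ p) * (b * d)       ∎
      where
      interchange : ∀ x y v w → x * y * (v * w) ≈ x * v * (y * w)
      interchange = solve 4 (λ x y v w → x :* y :* (v :* w) := x :* v :* (y :* w)) refl

    +-assoc-fraction : ∀ a b c m n p →
      X ^ p * (X ^ n * a + X ^ m * b) + X ^ (m ℕ.+ n) * c ≈ X ^ (n ℕ.+ p) * a + X ^ m * (X ^ p * b + X ^ n * c)
    +-assoc-fraction a b c m n p = begin
      X ^ p * (X ^ n * a + X ^ m * b) + X ^ (m ℕ.+ n) * c
        ≈⟨ +-congˡ (*-congʳ (homo m n)) ⟩
      X ^ p * (X ^ n * a + X ^ m * b) + X ^ m * X ^ n * c
        ≈⟨ solve 6 (λ m n p a b c → p :* (n :* a :+ m :* b) :+ m :* n :* c := n :* p :* a :+ m :* (p :* b :+ n :* c))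
             refl (X ^ m) (X ^ n) (X ^ p) a b c ⟩
      X ^ n * X ^ p * a + X ^ m * (X ^ p * b + X ^ n * c)
        ≈⟨ +-congʳ (*-congʳ (homo n p)) ⟨
      X ^ (n ℕ.+ p) * a + X ^ m * (X ^ p * b + X ^ n * c) ∎

    distribʳ-fraction : ∀ a b c m n p →
      X ^ ((n ℕ.+ m) ℕ.+ (p ℕ.+ m)) * ((X ^ p * b + X ^ n * c) * a) ≈
      X ^ ((n ℕ.+ p) ℕ.+ m) * (X ^ (p ℕ.+ m) * (b * a) + X ^ (n ℕ.+ m) * (c * a))
    distribʳ-fraction a b c m n p = begin
      X ^ ((n ℕ.+ m) ℕ.+ (p ℕ.+ m)) * ((X ^ p * b + X ^ n * c) * a)
        ≈⟨ *-congʳ (trans (homo (n ℕ.+ m) (p ℕ.+ m)) (*-cong (homo n m) (homo p m))) ⟩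
      X ^ n * X ^ m * (X ^ p * X ^ m) * ((X ^ p * b + X ^ n * c) * a)
        ≈⟨ solve 6 (λ m n p a b c → n :* m :* (p :* m) :* ((p :* b :+ n :* c) :* a) :=
                                    n :* p :* m :* (p :* m :* (b :* a) :+ n :* m :* (c :* a)))
             refl (X ^ m) (X ^ n) (X ^ p) a b c ⟩
      X ^ n * X ^ p * X ^ m * (X ^ p * X ^ m * (b * a) + X ^ n * X ^ m * (c * a))
        ≈⟨ *-cong (trans (homo (n ℕ.+ p) m) (*-congʳ (homo n p)))
                  (+-cong (*-congʳ (homo p m)) (*-congʳ (homo n m))) ⟨
      X ^ ((n ℕ.+ p) ℕ.+ m) * (X ^ (p ℕ.+ m) * (b * a) + X ^ (n ℕ.+ m) * (c * a)) ∎

    -‿cong-fraction : ∀ a b {m n} → X ^ n * a ≈ X ^ m * b → X ^ n * - a ≈ X ^ m * - b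
    -‿cong-fraction a b {m} {n} eq = begin
      X ^ n * - a   ≈⟨ solve 2 (λ x y → x :* :- y := :- (x :* y)) refl (X ^ n) a ⟩
      - (X ^ n * a) ≈⟨ -‿cong eq ⟩
      - (X ^ m * b) ≈⟨ solve 2 (λ x y → x :* :- y := :- (x :* y)) refl (X ^ m) b ⟨
      X ^ m * - b   ∎

    -‿inverseˡ-fraction : ∀ a m → X ^ 0 * (X ^ m * - a + X ^ m * a) ≈ X ^ (m ℕ.+ m) * 0#
    -‿inverseˡ-fraction a m = solve 3 (λ x y v → con (+ 1) :* (x :* :- y :+ x :* y) := v :* con (+ 0))
      refl (X ^ m) a (X ^ (m ℕ.+ m))

open import Data.Bool.Base using (true; false)
open import Data.Empty using (⊥-elim)
open import Data.Fin.Base using (toℕ; fromℕ; inject₁)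
import Data.Fin.Properties as Fin
open import Data.Integer.Base using (+≤+; 0ℤ)
open import Data.Integer.Solver renaming (module +-*-Solver to ℤ-Solver)
open import Data.List.Base
  using (List; []; _∷_; [_]; _++_; head; length; map; filter; upTo; applyUpTo; concatMap)
import Data.List.Properties as List
open import Data.List.Relation.Unary.Linked as Linked using ([-])
open import Data.Maybe.Relation.Unary.All as MaybeAll using (just; nothing)
open import Data.Maybe.Relation.Unary.Any as MaybeAny using (just)
open import Data.Nat.Base using (_≤_; _<_; z≤n; s≤s)
open import Data.Nat.Solver renaming (module +-*-Solver to ℕ-Solver)
open import Data.Product.Base using (_×_)
open import Data.Rational.Base as ℚ using (ℚ; ½; 0ℚ; 1ℚ)
import Data.Rational.Properties as ℚ
open import Data.Rational.Unnormalised.Base as ℚᵘ using (mkℚᵘ; *≡*)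
import Data.Rational.Unnormalised.Properties as ℚᵘ
open import Data.Sign.Base as Sign using (Sign)
import Data.Sign.Properties as Sign
open import Data.Sum.Base as Sum using (_⊎_; inj₁; inj₂)
open import Relation.Nullary.Decidable using (does; _×-dec_)
open import Relation.Nullary.Negation using (¬_)
open import Relation.Unary using (Pred; Decidable; _≐_)
open ≡ using (_≢_; refl; sym; trans; cong; cong₂; subst; module ≡-Reasoning)
open import Defs

open Arith ℚ⟦z⟧ using ()
  renaming (_≈_ to _≋_; _+_ to _⊕_; _*_ to _⊛_; _-_ to _⊖_; 1# to 𝟏; 2# to 𝟐; _^_ to _⊛^_)
open Arith ℚ.+-*-rawRing using (∑)

seriesRing : CommutativeRing 0ℓ 0ℓ
seriesRing = PowerSeriesProperties.powerSeriesRing ℚ.+-*-commutativeRing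

X : Series
X = indeterminate ℚ.+-*-rawRing

module S = CommutativeRing seriesRing
module Coefficients = PowerSeriesProperties ℚ.+-*-commutativeRing

open Fractions.PowersOf seriesRing X Coefficients.X*-cancel

laurent-laws : CommutativeRingLaws ℚ⦅z⦆
laurent-laws = record
  { isEquivalence = record
    { refl  = λ {(a /z^ m)} → S.refl {X ^ m S.* a}
    ; sym   = λ {(a /z^ m)} {(b /z^ n)} → S.sym {X ^ n S.* a} {X ^ m S.* b}
    ; trans = λ {(a /z^ m)} {(b /z^ n)} {(c /z^ p)} → ≈-trans a b c {m} {n} {p}
    }
  ; +-cong      = λ {(a /z^ m)} {(b /z^ n)} {(c /z^ p)} {(d /z^ q)} → +-cong-fraction a b c d {m} {n} {p} {q}
  ; +-assoc     = λ { (a /z^ m) (b /z^ n) (c /z^ p) → ≈-intro (+-assoc-fraction a b c m n p) (ℕ.+-assoc m n p) }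
  ; +-comm      = λ { (a /z^ m) (b /z^ n) → ≈-intro (S.+-comm (X ^ n S.* a) (X ^ m S.* b)) (ℕ.+-comm m n) }
  ; +-identityˡ = λ { (a /z^ m) → ≈-intro {b = a} {m} (S.trans {j = S.0# S.+ X ^ 0 S.* a}
                       (S.+-congʳ {X ^ 0 S.* a} (S.zeroʳ (X ^ m)))
                       (S.trans {j = X ^ 0 S.* a} (S.+-identityˡ (X ^ 0 S.* a)) (S.*-identityˡ a))) ≡.refl }
  ; -‿cong      = λ {(a /z^ m)} {(b /z^ n)} → -‿cong-fraction a b {m} {n}
  ; -‿inverseˡ  = λ { (a /z^ m) → -‿inverseˡ-fraction a m }
  ; *-cong      = λ {(a /z^ m)} {(b /z^ n)} {(c /z^ p)} {(d /z^ q)} → *-cong-fraction a b c d {m} {n} {p} {q}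
  ; *-assoc     = λ { (a /z^ m) (b /z^ n) (c /z^ p) → ≈-intro (S.*-assoc a b c) (ℕ.+-assoc m n p) }
  ; *-comm      = λ { (a /z^ m) (b /z^ n) → ≈-intro (S.*-comm a b) (ℕ.+-comm m n) }
  ; *-identityˡ = λ { (a /z^ m) → ≈-intro {m = m} (S.*-identityˡ a) ≡.refl }
  ; distribʳ    = λ { (a /z^ m) (b /z^ n) (c /z^ p) → distribʳ-fraction a b c m n p }
  }
  where open Arith ℚ⟦z⟧ using (_^_)

laurentRing : CommutativeRing 0ℓ 0ℓ
laurentRing = CommutativeRingLaws.commutativeRing laurent-laws

-- Counting paths by their last step

module Counting where
  open import Data.Nat.Base using (_+_)

  module _ {A : Set} where

    -- `count` ties the candidate words to the size, while removing a last step changes the size and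
    -- the candidates independently. Hence a count over an arbitrary list.
    tally : {P : Pred A 0ℓ} → Decidable P → List A → ℕ
    tally P? xs = length (filter P? xs)

    tally-≐ : {P Q : Pred A 0ℓ} (P? : Decidable P) (Q? : Decidable Q) → P ≐ Q → ∀ xs → tally P? xs ≡ tally Q? xs
    tally-≐ P? Q? P≐Q xs = cong length (List.filter-≐ P? Q? P≐Q xs)

    tally-∅ : {P : Pred A 0ℓ} (P? : Decidable P) → (∀ x → ¬ P x) → ∀ xs → tally P? xs ≡ 0
    tally-∅ P? ¬P []       = refl
    tally-∅ P? ¬P (x ∷ xs) with P? x
    ... | yes px = ⊥-elim (¬P x px)
    ... | no  _  = tally-∅ P? ¬P xs

    tally-⊎ : {P Q R : Pred A 0ℓ} (P? : Decidable P) (Q? : Decidable Q) (R? : Decidable R) →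
      (∀ {x} → P x → Q x ⊎ R x) → (∀ {x} → Q x → P x) → (∀ {x} → R x → P x) → (∀ {x} → Q x → ¬ R x) →
      ∀ xs → tally P? xs ≡ tally Q? xs + tally R? xs
    tally-⊎ P? Q? R? split q⇒p r⇒p disjoint []       = refl
    tally-⊎ P? Q? R? split q⇒p r⇒p disjoint (x ∷ xs)
      with P? x | Q? x | R? x | tally-⊎ P? Q? R? split q⇒p r⇒p disjoint xs
    ... | _     | yes q | yes r | _  = ⊥-elim (disjoint q r)
    ... | yes _ | yes _ | no  _ | ih = cong suc ih
    ... | yes _ | no  _ | yes _ | ih = trans (cong suc ih) (sym (ℕ.+-suc _ _))
    ... | no  _ | no  _ | no  _ | ih = ih
    ... | yes p | no ¬q | no ¬r | _  with split p
    ...   | inj₁ q = ⊥-elim (¬q q)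
    ...   | inj₂ r = ⊥-elim (¬r r)
    tally-⊎ P? Q? R? split q⇒p r⇒p disjoint (x ∷ xs) | no ¬p | yes q | no _  | _ = ⊥-elim (¬p (q⇒p q))
    tally-⊎ P? Q? R? split q⇒p r⇒p disjoint (x ∷ xs) | no ¬p | no _  | yes r | _ = ⊥-elim (¬p (r⇒p r))

    tally-++ : {P : Pred A 0ℓ} (P? : Decidable P) → ∀ xs ys → tally P? (xs ++ ys) ≡ tally P? xs + tally P? ys
    tally-++ P? xs ys = trans (cong length (List.filter-++ P? xs ys)) (List.length-++ (filter P? xs))

    tally-map : {P : Pred A 0ℓ} (P? : Decidable P) (φ : A → A) → ∀ xs → tally P? (map φ xs) ≡ tally (P? ∘ φ) xs
    tally-map P? φ []       = refl
    tally-map P? φ (x ∷ xs) with does (P? (φ x))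
    ... | true  = cong suc (tally-map P? φ xs)
    ... | false = tally-map P? φ xs

  ∑Step : (Step → ℕ) → ℕ
  ∑Step t = t N + (t N̄ + (t E + t Ē))

  ∑Step-cong : ∀ {t t′} → (∀ s → t s ≡ t′ s) → ∑Step t ≡ ∑Step t′
  ∑Step-cong eq = cong₂ _+_ (eq N) (cong₂ _+_ (eq N̄) (cong₂ _+_ (eq E) (eq Ē)))

  ∑Step-+ : ∀ t t′ → ∑Step t + ∑Step t′ ≡ ∑Step (λ s → t s + t′ s)
  ∑Step-+ t t′ = solve 8 (λ a b c d a′ b′ c′ d′ →
    (a :+ (b :+ (c :+ d))) :+ (a′ :+ (b′ :+ (c′ :+ d′))) := (a :+ a′) :+ ((b :+ b′) :+ ((c :+ c′) :+ (d :+ d′))))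
    refl (t N) (t N̄) (t E) (t Ē) (t′ N) (t′ N̄) (t′ E) (t′ Ē)
    where open ℕ-Solver

  words : List ℕ → List Path
  words = concatMap wordsOfLength

  module _ {P : Pred Path 0ℓ} (P? : Decidable P) where

    tally-wordsOfLength : ∀ m → tally P? (wordsOfLength (suc m)) ≡ ∑Step (λ s → tally (P? ∘ (s ∷_)) (wordsOfLength m))
    tally-wordsOfLength m = begin
      tally P? (map (N ∷_) W ++ (map (N̄ ∷_) W ++ (map (E ∷_) W ++ (map (Ē ∷_) W ++ []))))
        ≡⟨ split N _ ⟩
      t N + tally P? (map (N̄ ∷_) W ++ (map (E ∷_) W ++ (map (Ē ∷_) W ++ [])))
        ≡⟨ cong (t N ℕ.+_) (split N̄ _) ⟩
      t N + (t N̄ + tally P? (map (E ∷_) W ++ (map (Ē ∷_) W ++ [])))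
        ≡⟨ cong (λ x → t N + (t N̄ + x)) (split E _) ⟩
      t N + (t N̄ + (t E + tally P? (map (Ē ∷_) W ++ [])))
        ≡⟨ cong (λ x → t N + (t N̄ + (t E + x))) (trans (split Ē []) (ℕ.+-identityʳ _)) ⟩
      ∑Step t ∎
      where
      open ≡-Reasoning
      W = wordsOfLength m
      t : Step → ℕ
      t s = tally (P? ∘ (s ∷_)) W
      split : ∀ s ys → tally P? (map (s ∷_) W ++ ys) ≡ t s + tally P? ys
      split s ys = trans (tally-++ P? (map (s ∷_) W) ys) (cong (ℕ._+ tally P? ys) (tally-map P? (s ∷_) W))

    tally-words-map-suc : ∀ ms → tally P? (words (map suc ms)) ≡ ∑Step (λ s → tally (P? ∘ (s ∷_)) (words ms))
    tally-words-map-suc []       = refl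
    tally-words-map-suc (m ∷ ms) = begin
      tally P? (wordsOfLength (suc m) ++ words (map suc ms))
        ≡⟨ tally-++ P? (wordsOfLength (suc m)) (words (map suc ms)) ⟩
      tally P? (wordsOfLength (suc m)) + tally P? (words (map suc ms))
        ≡⟨ cong₂ _+_ (tally-wordsOfLength m) (tally-words-map-suc ms) ⟩
      ∑Step (λ s → tally (P? ∘ (s ∷_)) (wordsOfLength m)) + ∑Step (λ s → tally (P? ∘ (s ∷_)) (words ms))
        ≡⟨ ∑Step-+ (λ s → tally (P? ∘ (s ∷_)) (wordsOfLength m)) (λ s → tally (P? ∘ (s ∷_)) (words ms)) ⟩
      ∑Step (λ s → tally (P? ∘ (s ∷_)) (wordsOfLength m) + tally (P? ∘ (s ∷_)) (words ms))
        ≡⟨ ∑Step-cong (λ s → sym (tally-++ (P? ∘ (s ∷_)) (wordsOfLength m) (words ms))) ⟩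
      ∑Step (λ s → tally (P? ∘ (s ∷_)) (words (m ∷ ms))) ∎
      where open ≡-Reasoning

    -- Grouping the non-empty words by their last step permutes the list, which is ordered by length
    -- first; the decomposition therefore concerns the counts and not the lists.
    tally-words : ∀ M → tally P? (words (upTo (suc M))) ≡
                        tally P? [ [] ] + ∑Step (λ s → tally (P? ∘ (s ∷_)) (words (upTo M)))
    tally-words M = begin
      tally P? ([ [] ] ++ words (applyUpTo suc M))
        ≡⟨ tally-++ P? [ [] ] (words (applyUpTo suc M)) ⟩
      tally P? [ [] ] + tally P? (words (applyUpTo suc M))
        ≡⟨ cong (λ ms → tally P? [ [] ] + tally P? (words ms)) (List.map-upTo suc M) ⟨
      tally P? [ [] ] + tally P? (words (map suc (upTo M)))
        ≡⟨ cong (tally P? [ [] ] ℕ.+_) (tally-words-map-suc (upTo M)) ⟩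
      tally P? [ [] ] + ∑Step (λ s → tally (P? ∘ (s ∷_)) (words (upTo M))) ∎
      where open ≡-Reasoning

  -- The larger bound adds only words of length `M`, all of which violate `P`. The induction strips
  -- a step from every word at once through `tally-words`.
  tally-words-stable : ∀ M {P : Pred Path 0ℓ} (P? : Decidable P) → (∀ p → P p → length p < M) →
    tally P? (words (upTo (suc M))) ≡ tally P? (words (upTo M))
  tally-words-stable zero    P? short = tally-∅ P? (λ p px → ℕ.n≮0 (short p px)) [ [] ]
  tally-words-stable (suc M) P? short = begin
    tally P? (words (upTo (suc (suc M))))
      ≡⟨ tally-words P? (suc M) ⟩
    tally P? [ [] ] + ∑Step (λ s → tally (P? ∘ (s ∷_)) (words (upTo (suc M))))
      ≡⟨ cong (tally P? [ [] ] ℕ.+_) (∑Step-cong λ s →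
           tally-words-stable M (P? ∘ (s ∷_)) (λ p px → ℕ.s<s⁻¹ (short (s ∷ p) px))) ⟩
    tally P? [ [] ] + ∑Step (λ s → tally (P? ∘ (s ∷_)) (words (upTo M)))
      ≡⟨ tally-words P? M ⟨
    tally P? (words (upTo (suc M))) ∎
    where open ≡-Reasoning

  1≤Δx : ∀ s → 1 ≤ Δx s
  1≤Δx N = s≤s z≤n
  1≤Δx N̄ = s≤s z≤n
  1≤Δx E = s≤s z≤n
  1≤Δx Ē = s≤s z≤n

  length≤size : ∀ p → length p ≤ size p
  length≤size []      = z≤n
  length≤size (s ∷ p) = ℕ.+-mono-≤ (1≤Δx s) (length≤size p)

  Counted : Pred Path 0ℓ → ℕ → Pred Path 0ℓ
  Counted P n p = Zigzag p × size p ≡ n × P p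

  counted? : {P : Pred Path 0ℓ} → Decidable P → ∀ n → Decidable (Counted P n)
  counted? P? n p = zigzag? p ×-dec size p ℕ.≟ n ×-dec P? p

  count-≐ : {P Q : Pred Path 0ℓ} (P? : Decidable P) (Q? : Decidable Q) → ∀ n →
    (∀ p → size p ≡ n → P p → Q p) → (∀ p → size p ≡ n → Q p → P p) → count P? n ≡ count Q? n
  count-≐ P? Q? n P⇒Q Q⇒P = tally-≐ (counted? P? n) (counted? Q? n)
    ( (λ {p} (zz , sz , px) → zz , sz , P⇒Q p sz px)
    , (λ {p} (zz , sz , qx) → zz , sz , Q⇒P p sz qx)) (words (upTo (suc n)))

  count-⊎ : {P Q R : Pred Path 0ℓ} (P? : Decidable P) (Q? : Decidable Q) (R? : Decidable R) →
    (∀ {x} → P x → Q x ⊎ R x) → (∀ {x} → Q x → P x) → (∀ {x} → R x → P x) → (∀ {x} → Q x → ¬ R x) →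
    ∀ n → count P? n ≡ count Q? n + count R? n
  count-⊎ P? Q? R? split q⇒p r⇒p disjoint n = tally-⊎ (counted? P? n) (counted? Q? n) (counted? R? n)
    (λ (zz , sz , p) → Sum.map (λ q → zz , sz , q) (λ r → zz , sz , r) (split p))
    (λ (zz , sz , q) → zz , sz , q⇒p q) (λ (zz , sz , r) → zz , sz , r⇒p r)
    (λ (_ , _ , q) (_ , _ , r) → disjoint q r) (words (upTo (suc n)))

  -- The coefficients of zᵈ c(z).
  delay : ℕ → (ℕ → ℕ) → ℕ → ℕ
  delay zero    c n       = c n
  delay (suc d) c zero    = 0
  delay (suc d) c (suc n) = delay d c n

  -- Here `Q` says that `p` becomes a counted path once a step of width `d` is added. The words at
  -- hand have length below `M`, whereas `count` at size `n - d` takes lengths up to `n - d`. Since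
  -- `length≤size`, enlarging that bound changes nothing. For `n < d` no path qualifies.
  count-delay : ∀ d n {M} {P Q : Pred Path 0ℓ} (P? : Decidable P) (Q? : Decidable Q) → n < d + M →
    (∀ p → Q p → Zigzag p × d + size p ≡ n × P p) → (∀ p → Zigzag p × d + size p ≡ n × P p → Q p) →
    tally Q? (words (upTo M)) ≡ delay d (count P?) n
  count-delay zero    n {M} P? Q? n<M to from = trans
    (tally-≐ Q? (counted? P? n) ((λ {p} → to p) , (λ {p} → from p)) (words (upTo M)))
    (subst (λ m → tally (counted? P? n) (words (upTo m)) ≡ count P? n) (ℕ.m∸n+n≡m n<M) (stable (M ℕ.∸ suc n)))
    where
    stable : ∀ k → tally (counted? P? n) (words (upTo (k + suc n))) ≡ count P? n
    stable zero    = refl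
    stable (suc k) = trans (tally-words-stable (k + suc n) (counted? P? n) λ p (_ , sz , _) →
      ℕ.≤-trans (s≤s (ℕ.≤-trans (length≤size p) (ℕ.≤-reflexive sz))) (ℕ.m≤n+m (suc n) k)) (stable k)
  count-delay (suc d) zero {M} P? Q? n<M to from =
    tally-∅ Q? (λ p qx → ℕ.1+n≢0 (proj₁ (proj₂ (to p qx)))) (words (upTo M))
  count-delay (suc d) (suc n) P? Q? n<M to from = count-delay d n P? Q? (ℕ.s<s⁻¹ n<M)
    (λ p qx → let (zz , sz , px) = to p qx in zz , ℕ.suc-injective sz , px)
    (λ p (zz , sz , px) → from p (zz , cong suc sz , px))

  -- Recurrences by the last step, and reflection

  AtAltitude : ℤ → Pred Path 0ℓ → Pred Path 0ℓ
  AtAltitude j P p = altitude p ≡ j × P p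

  -- Vacuous at the empty path for both signs: a step in either direction may follow it, so it
  -- belongs to both classes. `Ends Sign.+` unfolds to `EndsUp`.
  Ends : Sign → Pred Path 0ℓ
  Ends σ p = MaybeAll.All (λ s → direction s ≡ σ) (head p)

  ends? : ∀ σ → Decidable (Ends σ)
  ends? σ p = MaybeAll.dec (λ s → direction s Sign.≟ σ) (head p)

  atAltitude? : ∀ j {P : Pred Path 0ℓ} → Decidable P → Decidable (AtAltitude j P)
  atAltitude? j P? p = altitude p ℤ.≟ j ×-dec P? p

  endingCount : Sign → ℤ → ℕ → ℕ
  endingCount σ j = count (atAltitude? j (ends? σ))

  ≢⇒≡opposite : ∀ {σ τ} → σ ≢ τ → τ ≡ Sign.opposite σ
  ≢⇒≡opposite {Sign.+} {Sign.+} σ≢τ = ⊥-elim (σ≢τ refl)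
  ≢⇒≡opposite {Sign.+} {Sign.-} σ≢τ = refl
  ≢⇒≡opposite {Sign.-} {Sign.+} σ≢τ = refl
  ≢⇒≡opposite {Sign.-} {Sign.-} σ≢τ = ⊥-elim (σ≢τ refl)

  zigzag-∷⁻ : ∀ s p → Zigzag (s ∷ p) → Zigzag p × Ends (Sign.opposite (direction s)) p
  zigzag-∷⁻ s []      _                  = Linked.[] , nothing
  zigzag-∷⁻ s (t ∷ p) (s≢t Linked.∷ zz) = zz , just (≢⇒≡opposite s≢t)

  zigzag-∷⁺ : ∀ s p → Zigzag p → Ends (Sign.opposite (direction s)) p → Zigzag (s ∷ p)
  zigzag-∷⁺ s []      _  _           = [-]
  zigzag-∷⁺ s (t ∷ p) zz (just t≡-s) = (λ s≡t → Sign.s≢opposite[s] (direction s) (trans s≡t t≡-s)) Linked.∷ zz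

  -- `B` may differ from `Ends σ` at the empty path only. The same recurrence thus serves `f` and
  -- `w`, which include the empty path, and `g`, which excludes it.
  module LastStep (σ : Sign) {B : Pred Path 0ℓ} (B? : Decidable B)
    (B⇒ : ∀ s p → B (s ∷ p) → direction s ≡ σ) (⇒B : ∀ s p → direction s ≡ σ → B (s ∷ p)) where

    lastStep : ℤ → ℕ → Step → ℕ
    lastStep j n s with direction s Sign.≟ σ
    ... | yes _ = delay (Δx s) (endingCount (Sign.opposite σ) (j ℤ.- Δy s)) n
    ... | no  _ = 0

    tally-lastStep : ∀ j n s →
      tally (counted? (atAltitude? j B?) n ∘ (s ∷_)) (words (upTo n)) ≡ lastStep j n s
    tally-lastStep j n s with direction s Sign.≟ σ
    ... | no  s≢σ  = tally-∅ (Q? ∘ (s ∷_)) (λ p (_ , _ , _ , b) → s≢σ (B⇒ s p b)) (words (upTo n))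
      where Q? = counted? (atAltitude? j B?) n
    ... | yes refl = count-delay (Δx s) n (atAltitude? (j ℤ.- Δy s) (ends? (Sign.opposite (direction s)))) (Q? ∘ (s ∷_)) (ℕ.+-monoˡ-≤ n (1≤Δx s))
      (λ p (zz , sz , alt , _) → let (zz′ , ends) = zigzag-∷⁻ s p zz in zz′ , sz , minus alt , ends)
      (λ p (zz , sz , alt , ends) → zigzag-∷⁺ s p zz ends , sz , plus alt , ⇒B s p refl)
      where
      open ℤ-Solver
      Q? = counted? (atAltitude? j B?) n
      minus : ∀ {a} → Δy s ℤ.+ a ≡ j → a ≡ j ℤ.- Δy s
      minus {a} refl = solve 2 (λ d a → a := d :+ a :- d) refl (Δy s) a
      plus : ∀ {a} → a ≡ j ℤ.- Δy s → Δy s ℤ.+ a ≡ j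
      plus refl = solve 2 (λ d j → d :+ (j :- d) := j) refl (Δy s) j

    count-lastStep : ∀ j n → count (atAltitude? j B?) n ≡
      tally (counted? (atAltitude? j B?) n) [ [] ] + ∑Step (lastStep j n)
    count-lastStep j n = trans (tally-words (counted? (atAltitude? j B?) n) n)
      (cong (tally (counted? (atAltitude? j B?) n) [ [] ] ℕ.+_) (∑Step-cong (tally-lastStep j n)))

  ends-∷⁻ : ∀ σ s p → Ends σ (s ∷ p) → direction s ≡ σ
  ends-∷⁻ σ s p (just eq) = eq

  ends-∷⁺ : ∀ σ s p → direction s ≡ σ → Ends σ (s ∷ p)
  ends-∷⁺ σ s p = just

  endsDown-∷⁻ : ∀ s p → EndsDown (s ∷ p) → direction s ≡ Sign.-
  endsDown-∷⁻ s p (just eq) = eq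

  endsDown-∷⁺ : ∀ s p → direction s ≡ Sign.- → EndsDown (s ∷ p)
  endsDown-∷⁺ s p = just

  module Up           = LastStep Sign.+ (ends? Sign.+) (ends-∷⁻ Sign.+) (ends-∷⁺ Sign.+)
  module Down         = LastStep Sign.- (ends? Sign.-) (ends-∷⁻ Sign.-) (ends-∷⁺ Sign.-)
  module ProperlyDown = LastStep Sign.- endsDown? endsDown-∷⁻ endsDown-∷⁺

  origin : ℤ → ℕ → ℕ
  origin (+ 0) 0 = 1
  origin _     _ = 0

  tally-origin : ∀ j n σ → tally (counted? (atAltitude? j (ends? σ)) n) [ [] ] ≡ origin j n
  tally-origin (+ zero)  zero    σ = refl
  tally-origin (+ suc _) zero    σ = refl
  tally-origin -[1+ _ ]  zero    σ = refl
  tally-origin (+ zero)  (suc _) σ = refl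
  tally-origin (+ suc _) (suc _) σ = refl
  tally-origin -[1+ _ ]  (suc _) σ = refl

  origin-neg : ∀ j n → origin (ℤ.- j) n ≡ origin j n
  origin-neg (+ zero)  n       = refl
  origin-neg (+ suc _) n       = refl
  origin-neg -[1+ _ ]  n       = refl

  endingCount-up : ∀ j n → endingCount Sign.+ j n ≡
    origin j n + (delay 1 (endingCount Sign.- (j ℤ.- + 2)) n + delay 2 (endingCount Sign.- (j ℤ.- + 1)) n)
  endingCount-up j n = trans (Up.count-lastStep j n) (cong₂ _+_ (tally-origin j n Sign.+)
    (cong (delay 1 (endingCount Sign.- (j ℤ.- + 2)) n ℕ.+_) (ℕ.+-identityʳ _)))

  properlyDown : ℤ → ℕ → ℕ
  properlyDown j n = delay 1 (endingCount Sign.+ (j ℤ.+ + 2)) n + delay 2 (endingCount Sign.+ (j ℤ.+ + 1)) n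

  endingCount-down : ∀ j n → endingCount Sign.- j n ≡ origin j n + properlyDown j n
  endingCount-down j n = trans (Down.count-lastStep j n) (cong₂ _+_ (tally-origin j n Sign.-)
    (cong (delay 1 (endingCount Sign.+ (j ℤ.+ + 2)) n ℕ.+_) refl))

  tally-endsDown : ∀ j n → tally (counted? (atAltitude? j endsDown?) n) [ [] ] ≡ 0
  tally-endsDown j n = cong length (List.filter-reject (counted? (atAltitude? j endsDown?) n) {[]} λ { (_ , _ , _ , ()) })

  count-endsDown : ∀ j n → count (atAltitude? j endsDown?) n ≡ properlyDown j n
  count-endsDown j n = trans (ProperlyDown.count-lastStep j n) (cong₂ _+_ (tally-endsDown j n) refl)

  -- No bijection on paths is built: the recurrences for the two directions are exchanged by
  -- `j ↦ - j`, and every last step lowers the size, so induction on the size applies. Steps of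
  -- width 2 require the hypothesis two sizes back, hence the three cases of `delayed`.
  endingCount-neg : ∀ n j → endingCount Sign.- j n ≡ endingCount Sign.+ (ℤ.- j) n
  endingCount-neg′ : ∀ n j i → i ≡ ℤ.- j → endingCount Sign.+ j n ≡ endingCount Sign.- i n
  endingCount-neg n j = begin
    endingCount Sign.- j n
      ≡⟨ endingCount-down j n ⟩
    origin j n + (delay 1 (endingCount Sign.+ (j ℤ.+ + 2)) n + delay 2 (endingCount Sign.+ (j ℤ.+ + 1)) n)
      ≡⟨ cong₂ _+_ (sym (origin-neg j n)) (delayed n) ⟩
    origin (ℤ.- j) n + (delay 1 (endingCount Sign.- (ℤ.- j ℤ.- + 2)) n + delay 2 (endingCount Sign.- (ℤ.- j ℤ.- + 1)) n)
      ≡⟨ endingCount-up (ℤ.- j) n ⟨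
    endingCount Sign.+ (ℤ.- j) n ∎
    where
    open ≡-Reasoning
    neg : ∀ d → ℤ.- j ℤ.- d ≡ ℤ.- (j ℤ.+ d)
    neg = solve 2 (λ j d → :- j :- d := :- (j :+ d)) refl j where open ℤ-Solver
    delayed : ∀ n → delay 1 (endingCount Sign.+ (j ℤ.+ + 2)) n + delay 2 (endingCount Sign.+ (j ℤ.+ + 1)) n ≡
      delay 1 (endingCount Sign.- (ℤ.- j ℤ.- + 2)) n + delay 2 (endingCount Sign.- (ℤ.- j ℤ.- + 1)) n
    delayed zero          = refl
    delayed (suc zero)    = cong₂ _+_ (endingCount-neg′ 0 (j ℤ.+ + 2) _ (neg (+ 2))) refl
    delayed (suc (suc n)) = cong₂ _+_ (endingCount-neg′ (suc n) (j ℤ.+ + 2) _ (neg (+ 2))) (endingCount-neg′ n (j ℤ.+ + 1) _ (neg (+ 1)))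
  endingCount-neg′ n j i refl = trans (cong (λ i → endingCount Sign.+ i n) (sym (ℤ.neg-involutive j))) (sym (endingCount-neg n (ℤ.- j)))

  -- From counts to series

  toℚ : ℕ → ℚ
  toℚ n = + n ℚ./ 1

  toℚ-+ : ∀ m n → toℚ (m + n) ≡ toℚ m ℚ.+ toℚ n
  toℚ-+ m n = ℚ.toℚᵘ-injective (begin
    ℚ.toℚᵘ (toℚ (m + n))                   ≈⟨ ℚ.toℚᵘ-fromℚᵘ (mkℚᵘ (+ (m + n)) 0) ⟩
    mkℚᵘ (+ (m + n)) 0                     ≈⟨ *≡* (solve 2 (λ x y → (x :+ y) :* con (+ 1) :=
                                                (x :* con (+ 1) :+ y :* con (+ 1)) :* con (+ 1)) refl (+ m) (+ n)) ⟩
    mkℚᵘ (+ m) 0 ℚᵘ.+ mkℚᵘ (+ n) 0         ≈⟨ ℚᵘ.+-cong (ℚ.toℚᵘ-fromℚᵘ (mkℚᵘ (+ m) 0)) (ℚ.toℚᵘ-fromℚᵘ (mkℚᵘ (+ n) 0)) ⟨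
    ℚ.toℚᵘ (toℚ m) ℚᵘ.+ ℚ.toℚᵘ (toℚ n)     ≈⟨ ℚ.toℚᵘ-homo-+ (toℚ m) (toℚ n) ⟨
    ℚ.toℚᵘ (toℚ m ℚ.+ toℚ n)               ∎)
    where
    open ℚᵘ.≃-Reasoning
    open ℤ-Solver

  toSeries : (ℕ → ℕ) → Series
  toSeries c n = toℚ (c n)

  toSeries-delay : ∀ d c → toSeries (delay (suc d) c) ≋ X ⊛ toSeries (delay d c)
  toSeries-delay d c zero    = sym (Coefficients.X*-zero (toSeries (delay d c)))
  toSeries-delay d c (suc n) = sym (Coefficients.X*-suc (toSeries (delay d c)) n)

  toSeries-delays : ∀ c d → toSeries (λ n → delay 1 c n + delay 2 d n) ≋ X ⊛ toSeries c ⊕ X ⊛ (X ⊛ toSeries d)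
  toSeries-delays c d n = trans (toℚ-+ (delay 1 c n) (delay 2 d n)) (cong₂ ℚ._+_ (toSeries-delay 0 c n)
    (trans (toSeries-delay 1 d n) (S.*-congˡ {X} (toSeries-delay 0 d) n)))

  -- w k = g k + [k = 0]: Ends Sign.- holds for the empty path as well.
  w : ℕ → Series
  w k = toSeries (endingCount Sign.- (+ k))

  constant-origin : ∀ k n → toℚ (origin (+ k) n) ≡ constant ℚ⟦z⟧ 𝟏 k n
  constant-origin zero    zero    = refl
  constant-origin zero    (suc n) = refl
  constant-origin (suc k) zero    = refl
  constant-origin (suc k) (suc n) = refl

  f≋w-zero : f 0 ≋ w 0
  f≋w-zero n = cong toℚ (sym (endingCount-neg n (+ 0)))

  -- Removing a last step `N` at altitude 1 leads to altitude -1. Reflection brings those paths back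
  -- to altitude 1, now ending up, so `f 1` recurs on the right.
  f-one : f 1 ≋ X ⊛ f 1 ⊕ X ⊛ (X ⊛ w 0)
  f-one n = begin
    toℚ (endingCount Sign.+ (+ 1) n)
      ≡⟨ cong toℚ (endingCount-up (+ 1) n) ⟩
    toℚ (delay 1 (endingCount Sign.- -[1+ 0 ]) n + delay 2 (endingCount Sign.- (+ 0)) n)
      ≡⟨ toSeries-delays (endingCount Sign.- -[1+ 0 ]) (endingCount Sign.- (+ 0)) n ⟩
    (X ⊛ toSeries (endingCount Sign.- -[1+ 0 ]) ⊕ X ⊛ (X ⊛ w 0)) n
      ≡⟨ S.+-congʳ {X ⊛ (X ⊛ w 0)} (S.*-congˡ {X} {y = f 1} (λ m → cong toℚ (endingCount-neg m -[1+ 0 ]))) n ⟩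
    (X ⊛ f 1 ⊕ X ⊛ (X ⊛ w 0)) n ∎
    where open ≡-Reasoning

  f-suc-suc : ∀ k → f (suc (suc k)) ≋ X ⊛ w k ⊕ X ⊛ (X ⊛ w (suc k))
  f-suc-suc k n = trans (cong toℚ (endingCount-up (+ suc (suc k)) n))
    (toSeries-delays (endingCount Sign.- (+ k)) (endingCount Sign.- (+ suc k)) n)

  properlyDown-series : ∀ k → toSeries (properlyDown (+ k)) ≋ X ⊛ f (suc (suc k)) ⊕ X ⊛ (X ⊛ f (suc k))
  properlyDown-series k n = trans
    (cong₂ (λ i j → toℚ (delay 1 (endingCount Sign.+ (+ i)) n + delay 2 (endingCount Sign.+ (+ j)) n)) (ℕ.+-comm k 2) (ℕ.+-comm k 1))
    (toSeries-delays (endingCount Sign.+ (+ suc (suc k))) (endingCount Sign.+ (+ suc k)) n)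

  w-down : ∀ k → w k ≋ constant ℚ⟦z⟧ 𝟏 k ⊕ (X ⊛ f (suc (suc k)) ⊕ X ⊛ (X ⊛ f (suc k)))
  w-down k n = trans (cong toℚ (endingCount-down (+ k) n)) (trans (toℚ-+ (origin (+ k) n) (properlyDown (+ k) n))
    (cong₂ ℚ._+_ (constant-origin k n) (properlyDown-series k n)))

  w≋1+g : ∀ k → w k ≋ constant ℚ⟦z⟧ 𝟏 k ⊕ g k
  w≋1+g k n = trans (cong toℚ (endingCount-down (+ k) n)) (trans (toℚ-+ (origin (+ k) n) (properlyDown (+ k) n))
    (cong₂ ℚ._+_ (constant-origin k n) (cong toℚ (sym (count-endsDown (+ k) n)))))

  endsUp⊎endsDown : ∀ p → EndsUp p ⊎ EndsDown p
  endsUp⊎endsDown []      = inj₁ nothing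
  endsUp⊎endsDown (N ∷ p) = inj₁ (just refl)
  endsUp⊎endsDown (N̄ ∷ p) = inj₂ (just refl)
  endsUp⊎endsDown (E ∷ p) = inj₁ (just refl)
  endsUp⊎endsDown (Ē ∷ p) = inj₂ (just refl)

  endsUp⇒¬endsDown : ∀ p → EndsUp p → ¬ EndsDown p
  endsUp⇒¬endsDown (s ∷ p) (just up) (just down) with () ← trans (sym up) down

  h≋f+g : ∀ k → h k ≋ f k ⊕ g k
  h≋f+g k n = trans (cong toℚ (count-⊎ (λ p → altitude p ℤ.≟ + k) (atAltitude? (+ k) endsUp?) (atAltitude? (+ k) endsDown?)
    (λ {p} alt → Sum.map (alt ,_) (alt ,_) (endsUp⊎endsDown p)) proj₁ proj₁
    (λ {p} (_ , up) (_ , down) → endsUp⇒¬endsDown p up down) n)) (toℚ-+ (count (atAltitude? (+ k) endsUp?) n) _)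

  -- No step is steeper than 2. At each size, only finitely many altitudes contribute to the sum of
  -- the `h k`.
  altitude≤2*size : ∀ p → altitude p ℤ.≤ + (size p + size p)
  altitude≤2*size []      = +≤+ z≤n
  altitude≤2*size (s ∷ p) = ℤ.≤-trans (ℤ.+-mono-≤ (Δy≤2Δx s) (altitude≤2*size p))
    (ℤ.≤-reflexive (cong +_ (solve 2 (λ x y → (x :+ x) :+ (y :+ y) := (x :+ y) :+ (x :+ y)) refl (Δx s) (size p))))
    where
    open ℕ-Solver
    Δy≤2Δx : ∀ s → Δy s ℤ.≤ + (Δx s + Δx s)
    Δy≤2Δx N = +≤+ (s≤s (s≤s z≤n))
    Δy≤2Δx N̄ = ℤ.-≤+
    Δy≤2Δx E = +≤+ (s≤s z≤n)
    Δy≤2Δx Ē = ℤ.-≤+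

  Between : ℕ → Pred Path 0ℓ
  Between K p = 0ℤ ℤ.≤ altitude p × altitude p ℤ.< + K

  between? : ∀ K → Decidable (Between K)
  between? K p = 0ℤ ℤ.≤? altitude p ×-dec altitude p ℤ.<? + K

  ∑-h : ∀ n K → ∑ {K} (λ k → h (toℕ k) n) ≡ toℚ (count (between? K) n)
  ∑-h n zero    = cong toℚ (sym (tally-∅ (counted? (between? 0) n) (λ p (_ , _ , 0≤a , a<0) → ℤ.≤⇒≯ 0≤a a<0) (words (upTo (suc n)))))
  ∑-h n (suc K) = begin
    ∑ {suc K} (λ k → h (toℕ k) n)
      ≡⟨ sum-init-last (λ (k : Fin (suc K)) → h (toℕ k) n) ⟩
    ∑ {K} (λ k → h (toℕ (inject₁ k)) n) ℚ.+ h (toℕ (fromℕ K)) n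
      ≡⟨ cong₂ ℚ._+_ (sum-cong-≗ {K} (λ k → cong (λ i → h i n) (Fin.toℕ-inject₁ k))) (cong (λ i → h i n) (Fin.toℕ-fromℕ K)) ⟩
    ∑ {K} (λ k → h (toℕ k) n) ℚ.+ h K n
      ≡⟨ cong (ℚ._+ h K n) (∑-h n K) ⟩
    toℚ (count (between? K) n) ℚ.+ h K n
      ≡⟨ toℚ-+ (count (between? K) n) _ ⟨
    toℚ (count (between? K) n + count (λ p → altitude p ℤ.≟ + K) n)
      ≡⟨ cong toℚ (count-⊎ (between? (suc K)) (between? K) (λ p → altitude p ℤ.≟ + K)
           (λ {p} → split {p}) (λ (0≤a , a<K) → 0≤a , ℤ.<-trans a<K K<1+K)
           (λ a≡K → subst (0ℤ ℤ.≤_) (sym a≡K) (+≤+ z≤n) , subst (ℤ._< + suc K) (sym a≡K) K<1+K)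
           (λ (_ , a<K) a≡K → ℤ.<-irrefl a≡K a<K) n) ⟨
    toℚ (count (between? (suc K)) n) ∎
    where
    open ≡-Reasoning
    open import Algebra.Properties.Monoid.Sum (CommutativeRing.+-monoid ℚ.+-*-commutativeRing) using (sum-init-last; sum-cong-≗)
    K<1+K : + K ℤ.< + suc K
    K<1+K = ℤ.+<+ ℕ.≤-refl
    i<1+K⇒i≤K : ∀ {i} → i ℤ.< + suc K → i ℤ.≤ + K
    i<1+K⇒i≤K {+ _}      (ℤ.+<+ (s≤s m≤K)) = +≤+ m≤K
    i<1+K⇒i≤K { -[1+ _ ]} _                 = ℤ.-≤+
    split : ∀ {p} → Between (suc K) p → Between K p ⊎ altitude p ≡ + K
    split {p} (0≤a , a<1+K) with altitude p ℤ.≟ + K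
    ... | yes a≡K = inj₂ a≡K
    ... | no  a≢K = inj₁ (0≤a , ℤ.≤∧≢⇒< (i<1+K⇒i≤K a<1+K) a≢K)

  h-sumsTo-h-total : h SumsTo h-total
  -- Paths of size `n` reach altitude at most `2n`, so partial sums over the altitudes below `K` are
  -- complete from `K = 2n + 1` on.
  h-sumsTo-h-total n = suc (n + n) , λ K 2n<K → trans (∑-h n K) (cong toℚ
    (count-≐ (between? K) (λ p → 0ℤ ℤ.≤? altitude p) n (λ p _ → proj₁)
      (λ { p refl 0≤a → 0≤a , ℤ.≤-<-trans (altitude≤2*size p) (ℤ.+<+ 2n<K) })))

open Counting

-- The series r and s

-- r = ρ and s = σ / z³.
ρ σ : Series
ρ n = LaurentSeries.numerator r (3 ℕ.+ n)
σ = LaurentSeries.numerator s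

half : Series
half = constant ℚ.+-*-rawRing ½

half+half : half ⊕ half ≋ 𝟏
half+half zero    = refl
half+half (suc n) = refl

√D² : √ D ⊛ √ D ≋ X ⊛^ 8 ⊖ 𝟐 ⊛ X ⊛^ 6 ⊖ X ⊛^ 4 ⊖ 𝟐 ⊛ X ⊛^ 2 ⊕ 𝟏
√D² = √-square D refl

R₀ : Series
R₀ = LaurentSeries.numerator r

R₀≋X³ρ : R₀ ≋ X ⊛^ 3 ⊛ ρ
R₀≋X³ρ = S.trans {R₀} (Coefficients.X³*-shift R₀ R₀-0 R₀-1 R₀-2) (S.sym {X ⊛^ 3 ⊛ ρ} (cube-* X ρ))
  where
  open RingIdentities seriesRing using (cube-*)
  R₀-0 : R₀ 0 ≡ 0ℚ
  R₀-0 = refl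
  R₀-1 : R₀ 1 ≡ 0ℚ
  R₀-1 = refl
  R₀-2 : R₀ 2 ≡ 0ℚ
  R₀-2 = refl

-- `D` is `(1 - z² - z⁴)² - 4z⁶`, so `√ D` and `1 - z² - z⁴` agree below degree 6; here the
-- coefficient is just computed. It makes `r` the root suited to the divisibility argument, as `s`
-- starts with `z⁻³`.
ρ-zero : ρ 0 ≡ 0ℚ
ρ-zero = refl

X³-cancel : ∀ a b → X ⊛^ 3 ⊛ a ≋ X ⊛^ 3 ⊛ b → a ≋ b
X³-cancel a b = X^*-cancel 3 {a} {b}

R₀σ≋X⁶ : R₀ ⊛ σ ≋ X ⊛^ 6
R₀σ≋X⁶ = product-conjugates {X} {half} {√ D} half+half √D²
  where open RingIdentities seriesRing

ρσ≋X³ : ρ ⊛ σ ≋ X ⊛^ 3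
ρσ≋X³ = RingIdentities.cancel-z³-product seriesRing {X} {ρ} {σ} {R₀} (λ {a} {b} → X³-cancel a b) R₀≋X³ρ R₀σ≋X⁶

X³ρ+σ : X ⊛^ 3 ⊛ ρ ⊕ σ ≋ 𝟏 ⊖ X ⊛^ 4 ⊖ X ⊛^ 2
X³ρ+σ = S.trans {X ⊛^ 3 ⊛ ρ ⊕ σ} {R₀ ⊕ σ} (S.+-congʳ {σ} (S.sym {R₀} R₀≋X³ρ))
  (RingIdentities.sum-conjugates seriesRing {X} {half} {√ D} half+half √D²)

w-suc≋g-suc : ∀ k → w (suc k) ≋ g (suc k)
w-suc≋g-suc k = S.trans {w (suc k)} (w≋1+g (suc k)) (S.+-identityˡ (g (suc k)))

w-down-suc : ∀ k → w (suc k) ≋ X ⊛ f (suc (suc (suc k))) ⊕ X ⊛ (X ⊛ f (suc (suc k)))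
w-down-suc k = S.trans {w (suc k)} (w-down (suc k)) (S.+-identityˡ _)

private
  open module Defect = RingIdentities.Kernel.Defect seriesRing {X} {ρ} {σ} ρσ≋X³ X³ρ+σ X³-cancel {f} {w}
    w-down-suc f-suc-suc using (defect; defect-divisible)

w-geometric : ∀ k → w (suc k) ≋ ρ ⊛ w k
w-geometric k = IntegerSolver.x-y≈0⇒x≈y seriesRing {w (suc k)} {ρ ⊛ w k} vanishes
  where
  defect≡0 : ∀ n → defect k n ≡ 0ℚ
  defect≡0 n = Coefficients.infinitely-divisible⇒0 {ρ} {defect} ρ-zero defect-divisible n ℕ.≤-refl k
  vanishes : defect k ≋ S.0#
  vanishes zero    = defect≡0 zero
  vanishes (suc n) = defect≡0 (suc n)

h-geometric : ∀ k → h (3 ℕ.+ k) ≋ ρ ⊛ h (2 ℕ.+ k)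
h-geometric = RingIdentities.h-geometric seriesRing {X} {ρ} {f} {g} {h} {w} h≋f+g w-suc≋g-suc f-suc-suc w-geometric

-- Sums of series in the z-adic topology

open CommutativeMonoidSum (CommutativeRing.+-commutativeMonoid ℚ.+-*-commutativeRing)
  using (sum-cong-≗; ∑-distrib-+)
open SemiringSum (CommutativeRing.semiring ℚ.+-*-commutativeRing) using (*-distribˡ-sum)

sumsTo-unique : ∀ {a t t′} → a SumsTo t → a SumsTo t′ → t ≋ t′
sumsTo-unique a⟶t a⟶t′ n with a⟶t n | a⟶t′ n
... | M , eq | M′ , eq′ = trans (sym (eq (M ℕ.⊔ M′) (ℕ.m≤m⊔n M M′))) (eq′ (M ℕ.⊔ M′) (ℕ.m≤n⊔m M M′))

sumsTo-cong : ∀ {a b t} → (∀ k → a k ≋ b k) → a SumsTo t → b SumsTo t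
sumsTo-cong {a} {b} a≋b a⟶t n with a⟶t n
... | M , eq = M , λ K M≤K → trans (sum-cong-≗ {K} (λ k → sym (a≋b (toℕ k) n))) (eq K M≤K)

sumsTo-tail : ∀ {a t} → a SumsTo t → (a ∘ suc) SumsTo (t ⊖ a 0)
sumsTo-tail {a} {t} a⟶t n with a⟶t n
... | M , eq = M , λ K M≤K → begin
  ∑ {K} (λ k → a (suc (toℕ k)) n)                            ≡⟨ cancel (a 0 n) _ ⟩
  a 0 n ℚ.+ ∑ {K} (λ k → a (suc (toℕ k)) n) ℚ.+ ℚ.- a 0 n    ≡⟨ cong (λ x → x ℚ.+ ℚ.- a 0 n) (eq (suc K) (ℕ.m≤n⇒m≤1+n M≤K)) ⟩
  t n ℚ.+ ℚ.- a 0 n                                          ∎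
  where
  open ≡-Reasoning
  open IntegerSolver ℚ.+-*-commutativeRing
  cancel : ∀ x y → y ≡ x ℚ.+ y ℚ.+ ℚ.- x
  cancel = solve 2 (λ x y → y := x :+ y :- x) refl

-- The coefficient of index `n` of a product involves only finitely many coefficients of the
-- summands, so the maximum of their thresholds works. The induction on `n` shifts `c`, which must
-- therefore vary.
sumsTo-* : ∀ c {a t} → a SumsTo t → (λ k → c ⊛ a k) SumsTo (c ⊛ t)
sumsTo-* c {a} {t} a⟶t n = product n c
  where
  open ≡-Reasoning
  product : ∀ n c → ∃ λ M → ∀ K → M ≤ K → ∑ {K} (λ k → (c ⊛ a (toℕ k)) n) ≡ (c ⊛ t) n
  product zero c with a⟶t 0
  ... | M , eq = M , λ K M≤K → begin
    ∑ {K} (λ k → c 0 ℚ.* a (toℕ k) 0 ℚ.+ 0ℚ)     ≡⟨ sum-cong-≗ {K} (λ k → ℚ.+-identityʳ (c 0 ℚ.* a (toℕ k) 0)) ⟩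
    ∑ {K} (λ k → c 0 ℚ.* a (toℕ k) 0)            ≡⟨ *-distribˡ-sum (c 0) (λ (k : Fin K) → a (toℕ k) 0) ⟨
    c 0 ℚ.* ∑ {K} (λ k → a (toℕ k) 0)            ≡⟨ cong (c 0 ℚ.*_) (eq K M≤K) ⟩
    c 0 ℚ.* t 0                                  ≡⟨ ℚ.+-identityʳ (c 0 ℚ.* t 0) ⟨
    c 0 ℚ.* t 0 ℚ.+ 0ℚ                           ∎
  product (suc n) c with a⟶t (suc n) | product n (c ∘ suc)
  ... | M , eq | M′ , eq′ = M ℕ.⊔ M′ , λ K M≤K → begin
    ∑ {K} (λ k → c 0 ℚ.* a (toℕ k) (suc n) ℚ.+ ((c ∘ suc) ⊛ a (toℕ k)) n)
      ≡⟨ ∑-distrib-+ {K} (λ k → c 0 ℚ.* a (toℕ k) (suc n)) (λ k → ((c ∘ suc) ⊛ a (toℕ k)) n) ⟩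
    ∑ {K} (λ k → c 0 ℚ.* a (toℕ k) (suc n)) ℚ.+ ∑ {K} (λ k → ((c ∘ suc) ⊛ a (toℕ k)) n)
      ≡⟨ cong₂ ℚ._+_ (trans (sym (*-distribˡ-sum (c 0) (λ (k : Fin K) → a (toℕ k) (suc n))))
           (cong (c 0 ℚ.*_) (eq K (ℕ.m⊔n≤o⇒m≤o M M′ M≤K)))) (eq′ K (ℕ.m⊔n≤o⇒n≤o M M′ M≤K)) ⟩
    c 0 ℚ.* t (suc n) ℚ.+ ((c ∘ suc) ⊛ t) n ∎

-- Both sides are sums of the sequence `h (3 + k)`: the left as a tail of `h`, the right as `ρ`
-- times the tail one index earlier, by `h-geometric`.
h-total-eq : h-total ⊖ h 0 ⊖ h 1 ⊖ h 2 ≋ ρ ⊛ (h-total ⊖ h 0 ⊖ h 1)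
h-total-eq = sumsTo-unique {λ k → h (3 ℕ.+ k)} (sumsTo-tail {λ k → h (2 ℕ.+ k)} {h-total ⊖ h 0 ⊖ h 1} tail₂)
  (sumsTo-cong {λ k → ρ ⊛ h (2 ℕ.+ k)} (λ k → S.sym {h (3 ℕ.+ k)} (h-geometric k))
    (sumsTo-* ρ {λ k → h (2 ℕ.+ k)} {h-total ⊖ h 0 ⊖ h 1} tail₂))
  where
  tail₂ : (λ k → h (2 ℕ.+ k)) SumsTo (h-total ⊖ h 0 ⊖ h 1)
  tail₂ = sumsTo-tail {λ k → h (1 ℕ.+ k)} {h-total ⊖ h 0} (sumsTo-tail {h} {h-total} h-sumsTo-h-total)

-- Inverses of two polynomials with constant term 1

1/[1-X] 1/[1-X²-2X³-X⁴] : Series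
1/[1-X] _ = 1ℚ

1/[1-X²-2X³-X⁴] 0 = 1ℚ
1/[1-X²-2X³-X⁴] 1 = 0ℚ
1/[1-X²-2X³-X⁴] 2 = 1ℚ
1/[1-X²-2X³-X⁴] 3 = 1ℚ ℚ.+ 1ℚ
1/[1-X²-2X³-X⁴] (suc (suc (suc (suc n)))) =
  1/[1-X²-2X³-X⁴] (suc (suc n)) ℚ.+
    (1/[1-X²-2X³-X⁴] (suc n) ℚ.+ (1/[1-X²-2X³-X⁴] (suc n) ℚ.+ 1/[1-X²-2X³-X⁴] n))

1/[1-X]-eq : 1/[1-X] ≋ 𝟏 ⊕ X ⊛ 1/[1-X]
1/[1-X]-eq zero    = cong (1ℚ ℚ.+_) (sym (Coefficients.X*-zero 1/[1-X]))
1/[1-X]-eq (suc n) = cong (0ℚ ℚ.+_) (sym (Coefficients.X*-suc 1/[1-X] n))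

-- The right-hand side is `1 + (X² + 2X³ + X⁴) v` in nested form, so every coefficient is reached by
-- shifting along single factors `X`.
1/[1-X²-2X³-X⁴]-eq : let v = 1/[1-X²-2X³-X⁴] in
  v ≋ 𝟏 ⊕ X ⊛ (X ⊛ (v ⊕ (X ⊛ v ⊕ X ⊛ (v ⊕ X ⊛ v))))
1/[1-X²-2X³-X⁴]-eq = recurrence
  where
  v a b c : Series
  v = 1/[1-X²-2X³-X⁴]
  a = v ⊕ X ⊛ v
  b = v ⊕ (X ⊛ v ⊕ X ⊛ a)
  c = X ⊛ b
  X²b : ∀ n → (X ⊛ c) (suc (suc n)) ≡ b n
  X²b n = trans (Coefficients.X*-suc c (suc n)) (Coefficients.X*-suc b n)
  recurrence : v ≋ 𝟏 ⊕ X ⊛ c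
  recurrence 0 = cong (1ℚ ℚ.+_) (sym (Coefficients.X*-zero c))
  recurrence 1 = cong (0ℚ ℚ.+_) (sym (trans (Coefficients.X*-suc c 0) (Coefficients.X*-zero b)))
  recurrence 2 = cong (0ℚ ℚ.+_) (sym (trans (X²b 0)
    (cong (1ℚ ℚ.+_) (cong₂ ℚ._+_ (Coefficients.X*-zero v) (Coefficients.X*-zero a)))))
  recurrence 3 = cong (0ℚ ℚ.+_) (sym (trans (X²b 1)
    (cong (0ℚ ℚ.+_) (cong₂ ℚ._+_ (Coefficients.X*-suc v 0) (trans (Coefficients.X*-suc a 0) (cong (1ℚ ℚ.+_) (Coefficients.X*-zero v)))))))
  recurrence (suc (suc (suc (suc n)))) = trans (sym (ℚ.+-identityˡ _)) (cong (0ℚ ℚ.+_) (sym (trans (X²b (suc (suc n)))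
    (cong (v (suc (suc n)) ℚ.+_) (cong₂ ℚ._+_ (Coefficients.X*-suc v (suc n))
      (trans (Coefficients.X*-suc a (suc n)) (cong (v (suc n) ℚ.+_) (Coefficients.X*-suc v n))))))))

-- Passage to Laurent series and conclusion

fromSeries-homomorphism : Homomorphism ℚ⟦z⟧ ℚ⦅z⦆
fromSeries-homomorphism = record
  { ⟦_⟧     = fromSeries
  ; ⟦⟧-cong = λ {a} {b} a≋b → S.*-congˡ {𝟏} {a} {b} a≋b
  ; +-homo  = λ a b → S.*-congˡ {𝟏} {a ⊕ b} {𝟏 ⊛ a ⊕ 𝟏 ⊛ b} (S.sym {𝟏 ⊛ a ⊕ 𝟏 ⊛ b} {a ⊕ b}
                        (S.+-cong {𝟏 ⊛ a} {a} {𝟏 ⊛ b} {b} (S.*-identityˡ a) (S.*-identityˡ b)))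
  ; *-homo  = λ a b → S.refl {𝟏 ⊛ (a ⊛ b)}
  ; -‿homo  = λ a → S.refl {𝟏 ⊛ (S.- a)}
  ; 1#-homo = S.refl {𝟏 ⊛ 𝟏}
  }

open Arith ℚ⦅z⦆ using () renaming (_≈_ to _≈ₗ_; _*_ to _*ₗ_; _^_ to _^ₗ_; 1# to 1ₗ)

ρ↦r : fromSeries ρ ≈ₗ r
ρ↦r = S.trans {X ⊛^ 3 ⊛ ρ} {R₀} {𝟏 ⊛ R₀} (S.sym {R₀} R₀≋X³ρ) (S.sym {𝟏 ⊛ R₀} (S.*-identityˡ R₀))

σ↦z³s : fromSeries σ ≈ₗ z ^ₗ 3 *ₗ s
σ↦z³s = S.sym {𝟏 ⊛ (X ⊛^ 3 ⊛ σ)} (S.*-identityˡ (X ⊛^ 3 ⊛ σ))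

rs≈1 : r *ₗ s ≈ₗ 1ₗ
rs≈1 = S.trans {𝟏 ⊛ (R₀ ⊛ σ)} {R₀ ⊛ σ} {X ⊛^ 6 ⊛ 𝟏} (S.*-identityˡ (R₀ ⊛ σ))
  (S.trans {R₀ ⊛ σ} {X ⊛^ 6} R₀σ≋X⁶ (S.sym {X ⊛^ 6 ⊛ 𝟏} (S.*-identityʳ (X ⊛^ 6))))

zz⁻¹≈1 : z *ₗ (𝟏 /z^ 1) ≈ₗ 1ₗ
zz⁻¹≈1 = S.*-comm 𝟏 (X ⊛ 𝟏)

formulas : Formulas {L = ℚ⦅z⦆} {ℚ⦅z⦆⟦u⟧} ⟨_⟩ z r s f₀ H[1] u F G H
formulas = Solution.formulas seriesRing laurentRing fromSeries-homomorphism
  {X} {ρ} {σ} {1/[1-X]} {1/[1-X²-2X³-X⁴]} {h-total} {f} {g} {h} {w}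
  (λ {a} {b} → Coefficients.X*-cancel a b) ρσ≋X³ X³ρ+σ 1/[1-X]-eq 1/[1-X²-2X³-X⁴]-eq
  (S.sym {f 0} f≋w-zero) w-geometric (w-down 0) (w≋1+g 0) w-suc≋g-suc f-one f-suc-suc h≋f+g h-total-eq
  {r} {s} {z} {𝟏 /z^ 1} (S.refl {𝟏 ⊛ X}) ρ↦r σ↦z³s rs≈1 zz⁻¹≈1

theorem3p1 : (let open Arith ℚ⦅z⦆⟦u⟧ in
    (F ≈ (- (u ^ 2) - u * (⟨ r ⟩ + ⟨ z ⟩) - ⟨ z ⟩ ^ 2 * ⟨ f₀ ⟩ * ⟨ s ⟩)
    / (⟨ z ⟩ ^ 2 * (u - ⟨ s ⟩)))
    × (G ≈ (- (⟨ z ⟩ ^ 2 * u) - ⟨ z ⟩ ^ 2 * ⟨ f₀ ⟩ * ⟨ s ⟩ + ⟨ z ⟩ ^ 2 * ⟨ s ⟩)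
    / (⟨ z ⟩ ^ 2 * (u - ⟨ s ⟩)))
    × (H ≈ F + G)
    × (H ≈ - (u ^ 2 + u * (⟨ r ⟩ + ⟨ z ⟩ + ⟨ z ⟩ ^ 2) + ⟨ z ⟩ ^ 2 * ⟨ s ⟩ * (2# * ⟨ f₀ ⟩ - 1#))
    / (⟨ z ⟩ ^ 2 * (u - ⟨ s ⟩))))
    × (let open Arith ℚ⦅z⦆ in
    (f₀ ≈ (r * (z - 1#)) / (z ^ 3 * (r * z ^ 2 + z - 1#)))
    × (H[1] ≈ - (1# + r + z + z ^ 2 + z ^ 2 * s * (2# * f₀ - 1#))
    / (z ^ 2 * (1# - s))))
    × (h SumsTo h-total)
theorem3p1 = (F-quotient , G-quotient , H≈F+G , H-quotient) , (f₀-quotient , T-quotient) , h-sumsTo-h-total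
  where open Formulas formulas
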